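{- Let $\alpha > 0$, let $\mathcal{H} = (\mathcal{H}_n)_{n\in\mathbb{N}}$ be a sequence of $3$-uniform hypergraphs with $|V(\mathcal{H}_n)| = n$, and let $\mathcal{B} = (\mathcal{B}_n)_{n\in\mathbb{N}}$ where each $\mathcal{B}_n$ is a family of subsets of $V(\mathcal{H}_n)$. Suppose $\mathcal{H}$ is $(\alpha,\mathcal{B})$-stable, $e(\mathcal{H}_n) = \Theta(n^2)$ and $\Delta_2(\mathcal{H}_n) = O(1)$. If $\|\mathcal{B}_n\| \geqslant \alpha n$, then for every $\delta > 0$ there exists $C > 0$ such that the following holds: there is $\varepsilon = \varepsilon(\mathcal{H},\delta) > 0$ such that if $m \geqslant C\sqrt{n}$ and $n$ is sufficiently large, then $$\big|\mathrm{SF}^{(\delta)}_{\geqslant}(\mathcal{H}_n,\mathcal{B}_n,m)\big| \leqslant \Big(2^{ -\varepsilon m} + \delta^m |\mathcal{B}_n|\Big)\binom{\|\mathcal{B}_n\|}{m}.$$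
   Context: $\mathrm{SF}(\mathcal{H}_n,m)$ is the family of independent sets (sets containing no edge) of size $m$ in $\mathcal{H}_n$, and $\mathrm{SF}^{(\delta)}_{\geqslant}(\mathcal{H}_n,\mathcal{B}_n,m) = \{I \in \mathrm{SF}(\mathcal{H}_n,m) : |I\setminus B| \geqslant \delta m \text{ for every } B \in \mathcal{B}_n\}$. $|\mathcal{B}_n|$ is the number of sets in $\mathcal{B}_n$ and $\|\mathcal{B}_n\| = \max\{|B| : B\in\mathcal{B}_n\}$. $\mathcal{H}$ is $(\alpha,\mathcal{B})$-stable if for every $\gamma > 0$ there exists $\beta > 0$ such that for all $n$: if $A \subseteq V(\mathcal{H}_n)$ with $|A| \geqslant (\alpha-\beta)n$, then either $e(\mathcal{H}_n[A]) \geqslant \beta e(\mathcal{H}_n)$ or $|A\setminus B| \leqslant \gamma n$ for some $B \in \mathcal{B}_n$. $\Delta_2(\mathcal{H}_n)$ is the maximum number of edges of $\mathcal{H}_n$ containing a given pair of vertices.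
   Formalization: The formal theorem takes α and δ (and the γ, β of stability) to be rational rather than real; C and ε are obtained rational, so only irrational α is genuinely not covered. -}

module Defs where

open import Data.Bool using (Bool; true; false; T; _∧_; _∨_; not)
open import Data.Nat as ℕ using (ℕ; zero; suc; _⊔_)
open import Data.Fin using (Fin)
open import Data.Nat.Combinatorics using (_C_)
open import Data.Fin.Subset using (Subset; inside; outside; ∣_∣; _─_; _⊆_; _∈_)
open import Data.Fin.Subset.Properties using (_⊆?_; _∈?_)
open import Data.List using (List; []; _∷_; map; _++_; length; filterᵇ; foldr)
open import Data.Vec using (Vec; []; _∷_)
open import Data.Integer using (+_)
open import Data.Rational using (ℚ; _/_; _*_; _-_; _≤_; _<_; 0ℚ; 1ℚ)
open import Data.Rational.Properties using (_≤?_)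
open import Data.Product using (Σ; _×_; ∃-syntax)
open import Data.Sum using (_⊎_)
open import Relation.Nullary.Decidable using (⌊_⌋)
open import Relation.Binary.PropositionalEquality using (_≡_; _≢_)

allᵇ : {A : Set} → (A → Bool) → List A → Bool
allᵇ p xs = foldr (λ x b → p x ∧ b) true xs

binom : ℕ → ℕ → ℕ
binom a b = a C b

⟦_⟧ : ℕ → ℚ
⟦ n ⟧ = + n / 1

_^ℚ_ : ℚ → ℕ → ℚ
q ^ℚ zero = 1ℚ
q ^ℚ suc k = q * (q ^ℚ k)

allSubsets : (n : ℕ) → List (Subset n)
allSubsets zero = [] ∷ []
allSubsets (suc n) = map (outside ∷_) (allSubsets n) ++ map (inside ∷_) (allSubsets n)

countSub : {n : ℕ} → (Subset n → Bool) → ℕ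
countSub {n} p = length (filterᵇ p (allSubsets n))

record Hypergraph3 (n : ℕ) : Set where
  field
    edge    : Subset n → Bool
    uniform : (e : Subset n) → T (edge e) → ∣ e ∣ ≡ 3
open Hypergraph3 public

Family : ℕ → Set
Family n = Subset n → Bool

eH : {n : ℕ} → Hypergraph3 n → ℕ
eH H = countSub (edge H)

eInduced : {n : ℕ} → Hypergraph3 n → Subset n → ℕ
eInduced H A = countSub (λ e → edge H e ∧ ⌊ e ⊆? A ⌋)

codeg : {n : ℕ} → Hypergraph3 n → Fin n → Fin n → ℕ
codeg H u v = countSub (λ e → edge H e ∧ (⌊ u ∈? e ⌋ ∧ ⌊ v ∈? e ⌋))

card : {n : ℕ} → Family n → ℕ
card B = countSub B

-- ‖B_n‖ = max { |B| : B ∈ B_n }   (0 for the empty family)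
norm : {n : ℕ} → Family n → ℕ
norm {n} B = foldr _⊔_ 0 (map ∣_∣ (filterᵇ B (allSubsets n)))

independentᵇ : {n : ℕ} → Hypergraph3 n → Subset n → Bool
independentᵇ {n} H I = allᵇ (λ e → not (edge H e ∧ ⌊ e ⊆? I ⌋)) (allSubsets n)

inSFᵇ : {n : ℕ} → Hypergraph3 n → Family n → ℚ → ℕ → Subset n → Bool
inSFᵇ {n} H B δ m I =
  ⌊ ∣ I ∣ ℕ.≟ m ⌋ ∧ (independentᵇ H I ∧
    allᵇ (λ X → not (B X) ∨ ⌊ δ * ⟦ m ⟧ ≤? ⟦ ∣ I ─ X ∣ ⟧ ⌋) (allSubsets n))

SFcount : {n : ℕ} → Hypergraph3 n → Family n → ℚ → ℕ → ℕ
SFcount H B δ m = countSub (inSFᵇ H B δ m)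

Stable : ℚ → ((n : ℕ) → Hypergraph3 n) → ((n : ℕ) → Family n) → Set
Stable α H B =
  (γ : ℚ) → 0ℚ < γ →
  ∃[ β ] (0ℚ < β ×
    ((n : ℕ) (A : Subset n) → (α - β) * ⟦ n ⟧ ≤ ⟦ ∣ A ∣ ⟧ →
      (β * ⟦ eH (H n) ⟧ ≤ ⟦ eInduced (H n) A ⟧)
      ⊎ (∃[ X ] (T (B n X) × ⟦ ∣ A ─ X ∣ ⟧ ≤ γ * ⟦ n ⟧))))

EdgesTheta : ((n : ℕ) → Hypergraph3 n) → Set
EdgesTheta H =
  ∃[ c ] ∃[ K ] ∃[ N ] (0ℚ < c × ((n : ℕ) → N ℕ.≤ n →
    (c * ⟦ n ℕ.* n ⟧ ≤ ⟦ eH (H n) ⟧) × (eH (H n) ℕ.≤ K ℕ.* (n ℕ.* n))))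

CodegBounded : ((n : ℕ) → Hypergraph3 n) → Set
CodegBounded H =
  ∃[ K ] ((n : ℕ) (u v : Fin n) → u ≢ v → codeg (H n) u v ℕ.≤ K)

{-# OPTIONS --safe #-}
module Submission where

open import Defs

-- The bound proved is |SF| ≤ 2^(−εm) C(N, m) with N = ‖B_n‖, by a container argument in the style
-- of Kleitman and Winston. To locate an unknown independent m-set I, query vertices v ∈ A ("is v
-- in I?"), starting from A = V. As long as H[A] is dense some v has degree of order n in H[A]; a
-- positive answer adds v to the fingerprint and its link, whose degrees are at most Δ₂ = O(1), to a
-- multigraph G on A. As soon as some v has degree m/Λ in G[A] it is queried instead, so all degrees
-- of G stay below m/Λ + O(1), and a positive answer deletes the G-neighbours of v, of which there
-- are at least of order m/Λ. Counting edges of G, there are O(m/Λ) positive answers of the first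
-- kind and O(Λn/m) of the second: at most ηm altogether if m ≥ C√n, with first Λ and then C large.
-- Hence summing over fingerprints costs a factor 2^(η′m) only. At a leaf H[A] is sparse, so by
-- stability either |A| ≤ (α − β)n, and C(|A|, m) is exponentially smaller than C(N, m), or
-- |A ∖ X| ≤ γn for some X ∈ B_n, and few m-subsets of A have δm elements outside X.

-- The order in which the constants are chosen shapes the argument. Stability returns β only after γ
-- is given, so γ may not depend on β. The alternative |A ─ X| ≤ γn is handled by an exponential
-- Markov inequality: with 1/d ≤ δ and z = 16^d, every I counted has weight z^|I ─ X| ≥ 16^m, while
-- the total weight of the k-subsets of A is at most 4^m C(N, k) once γ is of order α/z. That
-- comparison needs N - m to be at least of order αn, so N ≤ 2m is a separate case: there n = O(m),
-- and A ─ X has too little room for the part of I outside X. If even N - m < n/g, where 1/g ≤ β,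
-- stability applied to I itself shows that there is no I at all. The set X may change from leaf to
-- leaf, so no union over B_n is taken. All counting is done in ℕ, with each rational constant
-- replaced by the reciprocal of an integer. The value ε = 1/(4g) comes from raising the final
-- inequality to the power 4g, where g = f + 1 and (f/g)^g ≤ 1/2.

module Finite where

  open import Data.Bool using (Bool; true; false; T; _∧_; not; if_then_else_)
  import Data.Bool as Bool
  open import Data.Bool.Properties using (T-∧; T-≡)
  open import Data.Nat using (ℕ; zero; suc; _+_; _*_; _^_; _∸_; _/_; _⊔_; _≤_; _<_; z≤n; s≤s; s≤s⁻¹; NonZero; >-nonZero; >-nonZero⁻¹)
  open import Data.Nat.Properties
  open import Data.Nat.DivMod using (m/n*n≤m; m≥n⇒m/n>0; m≡m%n+[m/n]*n; m%n<n; /-monoˡ-≤; m*n/n≡m)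
  open import Data.Nat.Combinatorics using (_C_; nCk+nC[k+1]≡[n+1]C[k+1]; nC1≡n)
  open import Data.Nat.Tactic.RingSolver using (solve-∀)
  open import Data.Fin using (Fin; zero; suc)
  import Data.Fin as Fin
  open import Data.Fin.Properties using (any?)
  open import Data.Fin.Subset using (Subset; inside; outside; ∣_∣; _─_; _∩_; _∪_; _⊆_; _∈_; _∉_; ⁅_⁆; ⊥; ⊤)
  open import Data.Fin.Subset.Properties
  open import Data.List as List using (List; []; _∷_; filterᵇ; length)
  open import Data.List.Properties using (length-++; filter-++)
  open import Data.List.Membership.Propositional using () renaming (_∈_ to _∈ˡ_)
  open import Data.List.Membership.Propositional.Properties using (∈-++⁺ˡ; ∈-++⁺ʳ; ∈-map⁺; ∈-map⁻; ∈-filter⁺)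
  open import Data.List.Relation.Unary.Any using (here; there)
  open import Data.Vec using ([]; _∷_; here; there; tabulate)
  import Data.Vec.Properties as Vec
  open import Data.Product using (_×_; _,_; proj₁; proj₂; ∃-syntax)
  open import Data.Sum using (_⊎_; inj₁; inj₂; [_,_]′)
  open import Data.Empty using (⊥-elim)
  open import Function using (_∘_; Equivalence)
  open import Relation.Nullary using (¬_; yes; no)
  open import Relation.Nullary.Decidable using (⌊_⌋; toWitness; fromWitness; _×-dec_; T?)
  open import Relation.Binary.PropositionalEquality using (_≡_; _≢_; refl; sym; trans; cong; cong₂; subst; subst₂)
  open ≤-Reasoning

  private
    variable
      n : ℕ

  -- Inequalities between powers and binomial coefficients

  ^-distribʳ-* : ∀ k a b → (a * b) ^ k ≡ a ^ k * b ^ k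
  ^-distribʳ-* zero    a b = refl
  ^-distribʳ-* (suc k) a b = trans (cong (a * b *_) (^-distribʳ-* k a b)) (eq a b (a ^ k) (b ^ k))
    where
    eq : ∀ a b x y → a * b * (x * y) ≡ a * x * (b * y)
    eq = solve-∀

  bernoulli : ∀ f k → f ^ suc k + suc k * f ^ k ≤ suc f ^ suc k
  bernoulli f zero    = ≤-reflexive (eq f)
    where
    eq : ∀ f → f * 1 + 1 ≡ suc f * 1
    eq = solve-∀
  bernoulli f (suc k) = begin
    f * (f * F) + suc (suc k) * (f * F)           ≤⟨ m≤m+n _ (suc k * F) ⟩
    f * (f * F) + suc (suc k) * (f * F) + suc k * F ≡⟨ eq f k F ⟩
    suc f * (f * F + suc k * F)                   ≤⟨ *-monoʳ-≤ (suc f) (bernoulli f k) ⟩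
    suc f * suc f ^ suc k                         ∎
    where
    F = f ^ k
    eq : ∀ f k F → f * (f * F) + suc (suc k) * (f * F) + suc k * F ≡ suc f * (f * F + suc k * F)
    eq = solve-∀

  -- The gain per element will be a factor f/g; this shows that its g-th power is at most 1/2, which
  -- makes the gain a power of 2 with rational exponent.
  2*f^g≤g^g : ∀ f → 2 * f ^ suc f ≤ suc f ^ suc f
  2*f^g≤g^g f = begin
    2 * (f * f ^ f)                 ≤⟨ m≤m+n _ (f ^ f) ⟩
    2 * (f * f ^ f) + f ^ f         ≡⟨ eq f (f ^ f) ⟩
    f * f ^ f + suc f * f ^ f       ≤⟨ bernoulli f f ⟩
    suc f ^ suc f                   ∎
    where
    eq : ∀ f F → 2 * (f * F) + F ≡ f * F + suc f * F
    eq = solve-∀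

  -- (1 + 1/w)^y ≤ 1 + y/w + y²/w² for y ≤ w
  suc-pow-quadratic : ∀ w y → y ≤ w → w * w * suc w ^ y ≤ w ^ y * (w * w + y * w + y * y)
  suc-pow-quadratic w zero    _   = ≤-reflexive (eq w)
    where
    eq : ∀ w → w * w * 1 ≡ 1 * (w * w + 0 * w + 0 * 0)
    eq = solve-∀
  suc-pow-quadratic w (suc y) y<w = begin
    w * w * (suc w * suc w ^ y)                          ≡⟨ eq₁ w (suc w ^ y) ⟩
    suc w * (w * w * suc w ^ y)                          ≤⟨ *-monoʳ-≤ (suc w) (suc-pow-quadratic w y (<⇒≤ y<w)) ⟩
    suc w * (w ^ y * (w * w + y * w + y * y))            ≡⟨ eq₂ w y (w ^ y) ⟩
    w ^ y * (w * (w * w + y * w + y * y + w + y) + y * y) ≤⟨ *-monoʳ-≤ (w ^ y) (+-monoʳ-≤ (w * (w * w + y * w + y * y + w + y)) (*-mono-≤ (<⇒≤ y<w) (n≤1+n y))) ⟩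
    w ^ y * (w * (w * w + y * w + y * y + w + y) + w * suc y) ≡⟨ eq₃ w y (w ^ y) ⟩
    (w * w ^ y) * (w * w + suc y * w + suc y * suc y)    ∎
    where
    eq₁ : ∀ w x → w * w * (suc w * x) ≡ suc w * (w * w * x)
    eq₁ = solve-∀
    eq₂ : ∀ w y x → suc w * (x * (w * w + y * w + y * y)) ≡ x * (w * (w * w + y * w + y * y + w + y) + y * y)
    eq₂ = solve-∀
    eq₃ : ∀ w y x → x * (w * (w * w + y * w + y * y + w + y) + w * suc y) ≡ (w * x) * (w * w + suc y * w + suc y * suc y)
    eq₃ = solve-∀

  -- At y = w the quadratic bound gives the constant 3; it is rounded up to 4 so that the later
  -- factors 2^m, 4^m and 16^m combine.
  suc-pow≤4*pow : ∀ w y → y ≤ w → suc w ^ y ≤ 4 * w ^ y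
  suc-pow≤4*pow zero      zero z≤n = s≤s z≤n
  suc-pow≤4*pow w@(suc _) y    y≤w = *-cancelˡ-≤ (w * w) (begin
    w * w * suc w ^ y                        ≤⟨ suc-pow-quadratic w y y≤w ⟩
    w ^ y * (w * w + y * w + y * y)          ≤⟨ *-monoʳ-≤ (w ^ y) (+-mono-≤ (+-monoʳ-≤ (w * w) (*-monoˡ-≤ w y≤w)) (*-mono-≤ y≤w y≤w)) ⟩
    w ^ y * (w * w + w * w + w * w)          ≤⟨ m≤m+n _ (w ^ y * (w * w)) ⟩
    w ^ y * (w * w + w * w + w * w) + w ^ y * (w * w) ≡⟨ eq (w ^ y) w ⟩
    w * w * (4 * w ^ y)                      ∎)
    where
    eq : ∀ x w → x * (w * w + w * w + w * w) + x * (w * w) ≡ w * w * (4 * x)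
    eq = solve-∀

  -- Stands in for (1 + m/y)^y ≤ e^m. Each of the m unit increments of the base costs at most a
  -- factor 4, since the base never drops below the exponent.
  [y+m]^y≤y^y*4^m : ∀ y m → (y + m) ^ y ≤ y ^ y * 4 ^ m
  [y+m]^y≤y^y*4^m y zero    = ≤-reflexive (trans (cong (_^ y) (+-identityʳ y)) (sym (*-identityʳ (y ^ y))))
  [y+m]^y≤y^y*4^m y (suc m) = begin
    (y + suc m) ^ y       ≡⟨ cong (_^ y) (+-suc y m) ⟩
    suc (y + m) ^ y       ≤⟨ suc-pow≤4*pow (y + m) y (m≤m+n y m) ⟩
    4 * (y + m) ^ y       ≤⟨ *-monoʳ-≤ 4 ([y+m]^y≤y^y*4^m y m) ⟩
    4 * (y ^ y * 4 ^ m)   ≡⟨ eq (y ^ y) (4 ^ m) ⟩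
    y ^ y * (4 * 4 ^ m)   ∎
    where
    eq : ∀ a b → 4 * (a * b) ≡ a * (4 * b)
    eq = solve-∀

  -- Here hm/n ≤ m/y, so the previous bound applies; multiplying by y^y avoids the division.
  [n+h*m]^y≤n^y*4^m : ∀ n h m y → h * y ≤ n → (n + h * m) ^ y ≤ n ^ y * 4 ^ m
  [n+h*m]^y≤n^y*4^m n h m zero      _    = ≤-trans (m^n>0 4 m) (≤-reflexive (sym (+-identityʳ (4 ^ m))))
  [n+h*m]^y≤n^y*4^m n h m y@(suc _) hy≤n = *-cancelʳ-≤ _ _ (y ^ y) {{m^n≢0 y y}} (begin
    (n + h * m) ^ y * y ^ y     ≡⟨ ^-distribʳ-* y (n + h * m) y ⟨
    ((n + h * m) * y) ^ y       ≡⟨ cong (_^ y) (eq n h m y) ⟩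
    (n * y + (h * y) * m) ^ y   ≤⟨ ^-monoˡ-≤ y (+-monoʳ-≤ (n * y) (*-monoˡ-≤ m hy≤n)) ⟩
    (n * y + n * m) ^ y         ≡⟨ cong (_^ y) (*-distribˡ-+ n y m) ⟨
    (n * (y + m)) ^ y           ≡⟨ ^-distribʳ-* y n (y + m) ⟩
    n ^ y * (y + m) ^ y         ≤⟨ *-monoʳ-≤ (n ^ y) ([y+m]^y≤y^y*4^m y m) ⟩
    n ^ y * (y ^ y * 4 ^ m)     ≡⟨ eq′ (n ^ y) (y ^ y) (4 ^ m) ⟩
    n ^ y * 4 ^ m * y ^ y       ∎)
    where
    eq : ∀ n h m y → (n + h * m) * y ≡ n * y + (h * y) * m
    eq = solve-∀
    eq′ : ∀ a b c → a * (b * c) ≡ a * c * b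
    eq′ = solve-∀

  -- Ratios of binomial coefficients

  C-absorb-+ : ∀ n k → suc k * (n C suc k) + k * (n C k) ≡ n * (n C k)
  C-absorb-+ zero    zero    = refl
  C-absorb-+ zero    (suc k) = cong₂ _+_ (*-zeroʳ (suc (suc k))) (*-zeroʳ (suc k))
  C-absorb-+ (suc n) zero    = trans (eq (suc n C 1)) (trans (nC1≡n (suc n)) (sym (*-identityʳ (suc n))))
    where
    eq : ∀ c → 1 * c + 0 * 1 ≡ c
    eq = solve-∀
  C-absorb-+ (suc n) (suc k)
    rewrite sym (nCk+nC[k+1]≡[n+1]C[k+1] n k) | sym (nCk+nC[k+1]≡[n+1]C[k+1] n (suc k)) =
    trans (eq₁ k c₀ c₁ c₂)
   (trans (cong₂ (λ x y → x + c₁ + y + c₀) (C-absorb-+ n (suc k)) (C-absorb-+ n k))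
          (eq₂ n c₀ c₁))
    where
    c₀ = n C k
    c₁ = n C suc k
    c₂ = n C suc (suc k)
    eq₁ : ∀ k c₀ c₁ c₂ → suc (suc k) * (c₁ + c₂) + suc k * (c₀ + c₁)
        ≡ (suc (suc k) * c₂ + suc k * c₁) + c₁ + (suc k * c₁ + k * c₀) + c₀
    eq₁ = solve-∀
    eq₂ : ∀ n c₀ c₁ → n * c₁ + c₁ + n * c₀ + c₀ ≡ suc n * (c₀ + c₁)
    eq₂ = solve-∀

  C-absorb-∸ : ∀ n k → suc k * (n C suc k) ≡ (n ∸ k) * (n C k)
  C-absorb-∸ n k = begin-equality
    suc k * (n C suc k)                                   ≡⟨ m+n∸n≡m _ (k * (n C k)) ⟨
    (suc k * (n C suc k) + k * (n C k)) ∸ k * (n C k)     ≡⟨ cong (_∸ k * (n C k)) (C-absorb-+ n k) ⟩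
    n * (n C k) ∸ k * (n C k)                             ≡⟨ *-distribʳ-∸ (n C k) n k ⟨
    (n ∸ k) * (n C k)                                     ∎

  -- The ratio C(N, k+1) / C(N, k) is (N - k)/(k + 1), and the hypothesis says that N - k ≥ n/c.
  C-step-up : ∀ n c N k → c * k + n ≤ c * N → n * (N C k) ≤ c * suc k * (N C suc k)
  C-step-up n c N k ck+n≤cN = +-cancelˡ-≤ (c * k * (N C k)) _ _ (begin
    c * k * (N C k) + n * (N C k)                     ≡⟨ *-distribʳ-+ (N C k) (c * k) n ⟨
    (c * k + n) * (N C k)                             ≤⟨ *-monoˡ-≤ (N C k) ck+n≤cN ⟩
    c * N * (N C k)                                   ≡⟨ *-assoc c N (N C k) ⟩
    c * (N * (N C k))                                 ≡⟨ cong (c *_) (C-absorb-+ N k) ⟨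
    c * (suc k * (N C suc k) + k * (N C k))           ≡⟨ eq c k (N C suc k) (N C k) ⟩
    c * k * (N C k) + c * suc k * (N C suc k)         ∎)
    where
    eq : ∀ c k x y → c * (suc k * x + k * y) ≡ c * k * y + c * suc k * x
    eq = solve-∀

  -- A fingerprint of size s leaves k = m - s elements to be chosen; returning from C(N, k) to C(N,
  -- m) costs cm/n for each fingerprint element.
  C-climb : ∀ n c N m s k → c * m + n ≤ c * N → s + k ≤ m → n ^ s * (N C k) ≤ (c * m) ^ s * (N C (s + k))
  C-climb n c N m zero    k _  _       = ≤-refl
  C-climb n c N m (suc s) k hyp s+k<m = begin
    n * n ^ s * (N C k)                         ≡⟨ eq₁ n (n ^ s) (N C k) ⟩
    n ^ s * (n * (N C k))                       ≤⟨ *-monoʳ-≤ (n ^ s) (C-step-up n c N k (≤-trans (+-monoˡ-≤ n (*-monoʳ-≤ c (≤-trans (n≤1+n k) k<m))) hyp)) ⟩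
    n ^ s * (c * suc k * (N C suc k))           ≤⟨ *-monoʳ-≤ (n ^ s) (*-monoˡ-≤ (N C suc k) (*-monoʳ-≤ c k<m)) ⟩
    n ^ s * (c * m * (N C suc k))               ≡⟨ eq₁ (c * m) (n ^ s) (N C suc k) ⟨
    c * m * n ^ s * (N C suc k)                 ≡⟨ *-assoc (c * m) (n ^ s) _ ⟩
    c * m * (n ^ s * (N C suc k))               ≤⟨ *-monoʳ-≤ (c * m) (C-climb n c N m s (suc k) hyp (≤-trans (≤-reflexive (+-suc s k)) s+k<m)) ⟩
    c * m * ((c * m) ^ s * (N C (s + suc k)))   ≡⟨ *-assoc (c * m) ((c * m) ^ s) _ ⟨
    c * m * (c * m) ^ s * (N C (s + suc k))     ≡⟨ cong (λ j → c * m * (c * m) ^ s * (N C j)) (+-suc s k) ⟩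
    c * m * (c * m) ^ s * (N C suc (s + k))     ∎
    where
    k<m : suc k ≤ m
    k<m = ≤-trans (s≤s (m≤n+m k s)) s+k<m
    eq₁ : ∀ a b c → a * b * c ≡ b * (a * c)
    eq₁ = solve-∀

  -- If x/N ≤ f/g, then every factor (x - j)/(N - j) of the quotient is at most f/g too.
  C-shrink : ∀ f x N k → suc f * x ≤ f * N → suc f ^ k * (x C k) ≤ f ^ k * (N C k)
  C-shrink f x N zero    _   = ≤-refl
  C-shrink f x N (suc k) gx≤fN = *-cancelˡ-≤ (suc k) (begin
    suc k * (suc f * G * (x C suc k))         ≡⟨ eq (suc k) (suc f) G (x C suc k) ⟩
    suc f * G * (suc k * (x C suc k))         ≡⟨ cong (suc f * G *_) (C-absorb-∸ x k) ⟩
    suc f * G * ((x ∸ k) * (x C k))           ≡⟨ eq′ (suc f) G (x ∸ k) (x C k) ⟩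
    suc f * (x ∸ k) * (G * (x C k))           ≤⟨ *-mono-≤ shift (C-shrink f x N k gx≤fN) ⟩
    f * (N ∸ k) * (F * (N C k))               ≡⟨ eq′ f F (N ∸ k) (N C k) ⟨
    f * F * ((N ∸ k) * (N C k))               ≡⟨ cong (f * F *_) (C-absorb-∸ N k) ⟨
    f * F * (suc k * (N C suc k))             ≡⟨ eq (suc k) f F (N C suc k) ⟨
    suc k * (f * F * (N C suc k))             ∎)
    where
    G = suc f ^ k
    F = f ^ k
    shift : suc f * (x ∸ k) ≤ f * (N ∸ k)
    shift = begin
      suc f * (x ∸ k)         ≡⟨ *-distribˡ-∸ (suc f) x k ⟩
      suc f * x ∸ suc f * k   ≤⟨ ∸-mono gx≤fN (*-monoˡ-≤ k (n≤1+n f)) ⟩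
      f * N ∸ f * k           ≡⟨ *-distribˡ-∸ f N k ⟨
      f * (N ∸ k)             ∎
    eq : ∀ a b c d → a * (b * c * d) ≡ b * c * (a * d)
    eq = solve-∀
    eq′ : ∀ a b c d → a * b * (c * d) ≡ a * c * (b * d)
    eq′ = solve-∀

  C-mono : ∀ x N k → x ≤ N → x C k ≤ N C k
  C-mono x N zero    _   = ≤-refl
  C-mono zero    N       (suc k) _         = z≤n
  C-mono (suc x) (suc N) (suc k) (s≤s x≤N) = subst₂ _≤_ (nCk+nC[k+1]≡[n+1]C[k+1] x k) (nCk+nC[k+1]≡[n+1]C[k+1] N k)
    (+-mono-≤ (C-mono x N k x≤N) (C-mono x N (suc k) x≤N))

  -- mixedC z y x k = Σⱼ zʲ C(y, j) C(x, k − j)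
  mixedC : ℕ → ℕ → ℕ → ℕ → ℕ
  mixedC z zero    x k       = x C k
  mixedC z (suc y) x zero    = 1
  mixedC z (suc y) x (suc k) = mixedC z y x (suc k) + z * mixedC z y x k

  mixedC-zero : ∀ z y x → mixedC z y x 0 ≡ 1
  mixedC-zero z zero    x = refl
  mixedC-zero z (suc y) x = refl

  mixedC-suc : ∀ z y x k → mixedC z y (suc x) (suc k) ≡ mixedC z y x (suc k) + mixedC z y x k
  mixedC-suc z zero    x k = trans (sym (nCk+nC[k+1]≡[n+1]C[k+1] x k)) (+-comm (x C k) _)
  mixedC-suc z (suc y) x zero    rewrite mixedC-suc z y x 0 | mixedC-zero z y (suc x) | mixedC-zero z y x = eq (mixedC z y x 1) z
    where
    eq : ∀ a z → a + 1 + z * 1 ≡ a + z * 1 + 1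
    eq = solve-∀
  mixedC-suc z (suc y) x (suc k) rewrite mixedC-suc z y x (suc k) | mixedC-suc z y x k =
    eq z (mixedC z y x (suc (suc k))) (mixedC z y x (suc k)) (mixedC z y x k)
    where
    eq : ∀ z a b c → a + b + z * (b + c) ≡ a + z * b + (b + z * c)
    eq = solve-∀

  -- Choosing one of the y elements of weight z lowers k by one, which by `C-step-up` costs at most
  -- cm/n. Each of them thus contributes a factor 1 + z c m / n.
  mixedC-bound : ∀ n c N m z y x k → c * m + n ≤ c * N → x ≤ N → k ≤ m →
                 n ^ y * mixedC z y x k ≤ (n + z * (c * m)) ^ y * (N C k)
  mixedC-bound n c N m z zero    x k       hyp x≤N _   = *-monoʳ-≤ 1 (C-mono x N k x≤N)
  mixedC-bound n c N m z (suc y) x zero    hyp x≤N _   = *-monoˡ-≤ 1 (^-monoˡ-≤ (suc y) (m≤m+n n _))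
  mixedC-bound n c N m z (suc y) x (suc k) hyp x≤N k<m = begin
    n * n ^ y * (mixedC z y x (suc k) + z * mixedC z y x k)     ≡⟨ eq₁ n (n ^ y) (mixedC z y x (suc k)) z _ ⟩
    n * (n ^ y * mixedC z y x (suc k)) + z * n * (n ^ y * mixedC z y x k)
      ≤⟨ +-mono-≤ (*-monoʳ-≤ n (mixedC-bound n c N m z y x (suc k) hyp x≤N k<m))
                  (*-monoʳ-≤ (z * n) (mixedC-bound n c N m z y x k hyp x≤N (<⇒≤ k<m))) ⟩
    n * (W * (N C suc k)) + z * n * (W * (N C k))               ≡⟨ eq₂ n W (N C suc k) z (N C k) ⟩
    n * (W * (N C suc k)) + z * W * (n * (N C k))
      ≤⟨ +-monoʳ-≤ (n * (W * (N C suc k))) (*-monoʳ-≤ (z * W) (≤-trans (C-step-up n c N k below) (*-monoˡ-≤ (N C suc k) (*-monoʳ-≤ c k<m)))) ⟩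
    n * (W * (N C suc k)) + z * W * (c * m * (N C suc k))       ≡⟨ eq₃ n W (N C suc k) z c m ⟩
    (n + z * (c * m)) * W * (N C suc k)                         ∎
    where
    W = (n + z * (c * m)) ^ y
    below : c * k + n ≤ c * N
    below = ≤-trans (+-monoˡ-≤ n (*-monoʳ-≤ c (<⇒≤ k<m))) hyp
    eq₁ : ∀ n p a z b → n * p * (a + z * b) ≡ n * (p * a) + z * n * (p * b)
    eq₁ = solve-∀
    eq₂ : ∀ n w a z b → n * (w * a) + z * n * (w * b) ≡ n * (w * a) + z * w * (n * b)
    eq₂ = solve-∀
    eq₃ : ∀ n w a z c m → n * (w * a) + z * w * (c * m * a) ≡ (n + z * (c * m)) * w * a
    eq₃ = solve-∀

  -- Sums over subsets

  𝟙 : Bool → ℕ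
  𝟙 b = if b then 1 else 0

  𝟙-T : ∀ b → T b → 𝟙 b ≡ 1
  𝟙-T true _ = refl

  𝟙-mono : ∀ a b → (T a → T b) → 𝟙 a ≤ 𝟙 b
  𝟙-mono false b     _ = z≤n
  𝟙-mono true  b     f = ≤-reflexive (sym (𝟙-T b (f _)))

  𝟙-⊎ : ∀ a b c → (T a → T b ⊎ T c) → 𝟙 a ≤ 𝟙 b + 𝟙 c
  𝟙-⊎ false b c _ = z≤n
  𝟙-⊎ true  b c f with f _
  ... | inj₁ tb = ≤-trans (≤-reflexive (sym (𝟙-T b tb))) (m≤m+n _ _)
  ... | inj₂ tc = ≤-trans (≤-reflexive (sym (𝟙-T c tc))) (m≤n+m _ (𝟙 b))

  -- Recursion on the ground set instead of the list `allSubsets`, so that inductions can split on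
  -- whether the first vertex belongs to the subset.
  sumSub : (Subset n → ℕ) → ℕ
  sumSub {zero}  f = f []
  sumSub {suc n} f = sumSub (f ∘ (outside ∷_)) + sumSub (f ∘ (inside ∷_))

  length-filterᵇ-map : {A B : Set} (p : B → Bool) (f : A → B) (xs : List A) →
                       length (filterᵇ p (List.map f xs)) ≡ length (filterᵇ (p ∘ f) xs)
  length-filterᵇ-map p f []       = refl
  length-filterᵇ-map p f (x ∷ xs) with p (f x)
  ... | true  = cong suc (length-filterᵇ-map p f xs)
  ... | false = length-filterᵇ-map p f xs

  countSub≡sumSub : (p : Subset n → Bool) → countSub p ≡ sumSub (𝟙 ∘ p)
  countSub≡sumSub {zero} p with p []
  ... | true  = refl
  ... | false = refl
  countSub≡sumSub {suc n} p = begin-equality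
    length (filterᵇ p (out List.++ inn))                 ≡⟨ cong length (filter-++ (T? ∘ p) out inn) ⟩
    length (filterᵇ p out List.++ filterᵇ p inn)         ≡⟨ length-++ (filterᵇ p out) ⟩
    length (filterᵇ p out) + length (filterᵇ p inn)
      ≡⟨ cong₂ _+_ (trans (length-filterᵇ-map p (outside ∷_) (allSubsets n)) (countSub≡sumSub (p ∘ (outside ∷_))))
                   (trans (length-filterᵇ-map p (inside ∷_) (allSubsets n)) (countSub≡sumSub (p ∘ (inside ∷_)))) ⟩
    sumSub (𝟙 ∘ p)                                       ∎
    where
    out = List.map (outside ∷_) (allSubsets n)
    inn = List.map (inside ∷_) (allSubsets n)

  sumSub-mono : {f g : Subset n → ℕ} → (∀ I → f I ≤ g I) → sumSub f ≤ sumSub g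
  sumSub-mono {zero}  f≤g = f≤g []
  sumSub-mono {suc n} f≤g = +-mono-≤ (sumSub-mono (f≤g ∘ (outside ∷_))) (sumSub-mono (f≤g ∘ (inside ∷_)))

  sumSub-cong : {f g : Subset n → ℕ} → (∀ I → f I ≡ g I) → sumSub f ≡ sumSub g
  sumSub-cong f≡g = ≤-antisym (sumSub-mono (λ I → ≤-reflexive (f≡g I))) (sumSub-mono (λ I → ≤-reflexive (sym (f≡g I))))

  sumSub-+ : (f g : Subset n → ℕ) → sumSub (λ I → f I + g I) ≡ sumSub f + sumSub g
  sumSub-+ {zero}  f g = refl
  sumSub-+ {suc n} f g = trans
    (cong₂ _+_ (sumSub-+ (f ∘ (outside ∷_)) (g ∘ (outside ∷_))) (sumSub-+ (f ∘ (inside ∷_)) (g ∘ (inside ∷_))))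
    (interchange (sumSub (f ∘ (outside ∷_))) (sumSub (g ∘ (outside ∷_))) (sumSub (f ∘ (inside ∷_))) _)
    where
    interchange : ∀ a b c d → a + b + (c + d) ≡ a + c + (b + d)
    interchange = solve-∀

  sumSub-0 : sumSub {n} (λ _ → 0) ≡ 0
  sumSub-0 {zero}  = refl
  sumSub-0 {suc n} = cong₂ _+_ (sumSub-0 {n}) (sumSub-0 {n})

  sumSub-*ˡ : ∀ c (f : Subset n → ℕ) → sumSub (λ I → c * f I) ≡ c * sumSub f
  sumSub-*ˡ {zero}  c f = refl
  sumSub-*ˡ {suc n} c f = trans (cong₂ _+_ (sumSub-*ˡ c (f ∘ (outside ∷_))) (sumSub-*ˡ c (f ∘ (inside ∷_)))) (sym (*-distribˡ-+ c _ _))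

  countSub-⊎ : (p q r : Subset n → Bool) → (∀ I → T (p I) → T (q I) ⊎ T (r I)) →
               countSub p ≤ countSub q + countSub r
  countSub-⊎ p q r p⇒q⊎r
    rewrite countSub≡sumSub p | countSub≡sumSub q | countSub≡sumSub r =
    ≤-trans (sumSub-mono (λ I → 𝟙-⊎ (p I) (q I) (r I) (p⇒q⊎r I))) (≤-reflexive (sumSub-+ (𝟙 ∘ q) (𝟙 ∘ r)))

  countSub-mono : (p q : Subset n → Bool) → (∀ I → T (p I) → T (q I)) → countSub p ≤ countSub q
  countSub-mono p q p⇒q rewrite countSub≡sumSub p | countSub≡sumSub q =
    sumSub-mono (λ I → 𝟙-mono (p I) (q I) (p⇒q I))

  countSub-none : (p : Subset n → Bool) → (∀ I → ¬ T (p I)) → countSub p ≡ 0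
  countSub-none {n} p none = n≤0⇒n≡0 (begin
    countSub p            ≡⟨ countSub≡sumSub p ⟩
    sumSub (𝟙 ∘ p)        ≤⟨ sumSub-mono (λ I → 𝟙-mono (p I) false (none I)) ⟩
    sumSub {n} (λ _ → 0)  ≡⟨ sumSub-0 {n} ⟩
    0                     ∎)

  -- Sums over the vertices of a set

  sumOn : Subset n → (Fin n → ℕ) → ℕ
  sumOn []            f = 0
  sumOn (inside  ∷ A) f = f zero + sumOn A (f ∘ suc)
  sumOn (outside ∷ A) f = sumOn A (f ∘ suc)

  sumOn-mono : (A : Subset n) {f g : Fin n → ℕ} → (∀ x → x ∈ A → f x ≤ g x) → sumOn A f ≤ sumOn A g
  sumOn-mono []            f≤g = z≤n
  sumOn-mono (inside  ∷ A) f≤g = +-mono-≤ (f≤g zero here) (sumOn-mono A (λ x x∈A → f≤g (suc x) (there x∈A)))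
  sumOn-mono (outside ∷ A) f≤g = sumOn-mono A (λ x x∈A → f≤g (suc x) (there x∈A))

  sumOn-cong : (A : Subset n) {f g : Fin n → ℕ} → (∀ x → f x ≡ g x) → sumOn A f ≡ sumOn A g
  sumOn-cong A f≡g = ≤-antisym (sumOn-mono A (λ x _ → ≤-reflexive (f≡g x))) (sumOn-mono A (λ x _ → ≤-reflexive (sym (f≡g x))))

  sumOn-+ : (A : Subset n) (f g : Fin n → ℕ) → sumOn A (λ x → f x + g x) ≡ sumOn A f + sumOn A g
  sumOn-+ []            f g = refl
  sumOn-+ (outside ∷ A) f g = sumOn-+ A (f ∘ suc) (g ∘ suc)
  sumOn-+ (inside  ∷ A) f g = trans (cong (f zero + g zero +_) (sumOn-+ A (f ∘ suc) (g ∘ suc)))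
    (interchange (f zero) (g zero) (sumOn A (f ∘ suc)) _)
    where
    interchange : ∀ a b c d → a + b + (c + d) ≡ a + c + (b + d)
    interchange = solve-∀

  sumOn-const : (A : Subset n) (c : ℕ) → sumOn A (λ _ → c) ≡ ∣ A ∣ * c
  sumOn-const []            c = refl
  sumOn-const (inside  ∷ A) c = cong (c +_) (sumOn-const A c)
  sumOn-const (outside ∷ A) c = sumOn-const A c

  sumOn-1 : (A : Subset n) → sumOn A (λ _ → 1) ≡ ∣ A ∣
  sumOn-1 A = trans (sumOn-const A 1) (*-identityʳ ∣ A ∣)

  sumOn-≤ : (A : Subset n) {f : Fin n → ℕ} (c : ℕ) → (∀ x → x ∈ A → f x ≤ c) → sumOn A f ≤ ∣ A ∣ * c
  sumOn-≤ A c f≤c = ≤-trans (sumOn-mono A f≤c) (≤-reflexive (sumOn-const A c))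

  sumOn-0 : (A : Subset n) {f : Fin n → ℕ} → (∀ x → x ∈ A → f x ≡ 0) → sumOn A f ≡ 0
  sumOn-0 A f≡0 = n≤0⇒n≡0 (≤-trans (sumOn-≤ A 0 (λ x x∈A → ≤-reflexive (f≡0 x x∈A))) (≤-reflexive (*-zeroʳ ∣ A ∣)))

  sumOn-split : (A Y : Subset n) (f : Fin n → ℕ) → sumOn A f ≡ sumOn (A ─ Y) f + sumOn (A ∩ Y) f
  sumOn-split []            []            f = refl
  sumOn-split (outside ∷ A) (outside ∷ Y) f = sumOn-split A Y (f ∘ suc)
  sumOn-split (outside ∷ A) (inside  ∷ Y) f = sumOn-split A Y (f ∘ suc)
  sumOn-split (inside  ∷ A) (outside ∷ Y) f =
    trans (cong (f zero +_) (sumOn-split A Y (f ∘ suc))) (sym (+-assoc (f zero) _ _))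
  sumOn-split (inside  ∷ A) (inside  ∷ Y) f =
    trans (cong (f zero +_) (sumOn-split A Y (f ∘ suc))) (swap (f zero) (sumOn (A ─ Y) (f ∘ suc)) _)
    where
    swap : ∀ a b c → a + (b + c) ≡ b + (a + c)
    swap = solve-∀

  ∣∣-split : (A Y : Subset n) → ∣ A ∣ ≡ ∣ A ─ Y ∣ + ∣ A ∩ Y ∣
  ∣∣-split A Y = trans (sym (sumOn-1 A)) (trans (sumOn-split A Y (λ _ → 1)) (cong₂ _+_ (sumOn-1 (A ─ Y)) (sumOn-1 (A ∩ Y))))

  sumOn-⊆ : (A B : Subset n) (f : Fin n → ℕ) → A ⊆ B → sumOn A f ≤ sumOn B f
  sumOn-⊆ []            []            f A⊆B = z≤n
  sumOn-⊆ (outside ∷ A) (outside ∷ B) f A⊆B = sumOn-⊆ A B (f ∘ suc) (drop-∷-⊆ A⊆B)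
  sumOn-⊆ (outside ∷ A) (inside  ∷ B) f A⊆B = m≤n⇒m≤o+n (f zero) (sumOn-⊆ A B (f ∘ suc) (drop-∷-⊆ A⊆B))
  sumOn-⊆ (inside  ∷ A) (outside ∷ B) f A⊆B with () ← A⊆B here
  sumOn-⊆ (inside  ∷ A) (inside  ∷ B) f A⊆B = +-monoʳ-≤ (f zero) (sumOn-⊆ A B (f ∘ suc) (drop-∷-⊆ A⊆B))

  sumOn-swap : ∀ {k} (A : Subset n) (B : Subset k) (f : Fin n → Fin k → ℕ) →
               sumOn A (λ x → sumOn B (f x)) ≡ sumOn B (λ y → sumOn A (λ x → f x y))
  sumOn-swap []            B f = sym (sumOn-0 B (λ _ _ → refl))
  sumOn-swap (outside ∷ A) B f = sumOn-swap A B (f ∘ suc)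
  sumOn-swap (inside  ∷ A) B f = trans (cong (sumOn B (f zero) +_) (sumOn-swap A B (f ∘ suc)))
                                       (sym (sumOn-+ B (f zero) _))

  sumSub-sumOn-swap : ∀ {k} (A : Subset k) (f : Subset n → Fin k → ℕ) →
                      sumSub (λ I → sumOn A (f I)) ≡ sumOn A (λ x → sumSub (λ I → f I x))
  sumSub-sumOn-swap {n} []            f = sumSub-0 {n}
  sumSub-sumOn-swap     (outside ∷ A) f = sumSub-sumOn-swap A (λ I → f I ∘ suc)
  sumSub-sumOn-swap     (inside  ∷ A) f = trans (sumSub-+ (λ I → f I zero) _)
    (cong (sumSub (λ I → f I zero) +_) (sumSub-sumOn-swap A (λ I → f I ∘ suc)))

  sumOn-member : (A : Subset n) (f : Fin n → ℕ) {v : Fin n} → v ∈ A → f v ≤ sumOn A f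
  sumOn-member (inside  ∷ A) f here        = m≤m+n (f zero) _
  sumOn-member (inside  ∷ A) f (there v∈A) = m≤n⇒m≤o+n (f zero) (sumOn-member A (f ∘ suc) v∈A)
  sumOn-member (outside ∷ A) f (there v∈A) = sumOn-member A (f ∘ suc) v∈A

  sumOn-⁅⁆∪ : (S : Subset n) (v : Fin n) (f : Fin n → ℕ) → v ∉ S → sumOn (⁅ v ⁆ ∪ S) f ≡ f v + sumOn S f
  sumOn-⁅⁆∪ (inside  ∷ S) zero    f v∉S = ⊥-elim (v∉S here)
  sumOn-⁅⁆∪ (outside ∷ S) zero    f v∉S = cong (λ R → f zero + sumOn R (f ∘ suc)) (∪-identityˡ S)
  sumOn-⁅⁆∪ (outside ∷ S) (suc v) f v∉S = sumOn-⁅⁆∪ S v (f ∘ suc) (v∉S ∘ there)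
  sumOn-⁅⁆∪ (inside  ∷ S) (suc v) f v∉S =
    trans (cong (f zero +_) (sumOn-⁅⁆∪ S v (f ∘ suc) (v∉S ∘ there))) (swap (f zero) (f (suc v)) _)
    where
    swap : ∀ a b c → a + (b + c) ≡ b + (a + c)
    swap = solve-∀

  ∣⁅⁆∪∣ : (S : Subset n) (v : Fin n) → v ∉ S → ∣ ⁅ v ⁆ ∪ S ∣ ≡ suc ∣ S ∣
  ∣⁅⁆∪∣ S v v∉S = trans (sym (sumOn-1 (⁅ v ⁆ ∪ S))) (trans (sumOn-⁅⁆∪ S v (λ _ → 1) v∉S) (cong suc (sumOn-1 S)))

  Disjoint : Subset n → Subset n → Set
  Disjoint S A = ∀ {x} → x ∈ S → x ∉ A

  sumSub-none : (p : Subset n → Bool) (w : Subset n → ℕ) (c : ℕ) → (∀ I → ¬ T (p I)) → sumSub (λ I → 𝟙 (p I) * w I) ≤ c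
  sumSub-none {n} p w c none = ≤-trans (sumSub-mono zeroTerm) (≤-trans (≤-reflexive (sumSub-0 {n})) z≤n)
    where
    zeroTerm : ∀ I → 𝟙 (p I) * w I ≤ 0
    zeroTerm I = *-monoˡ-≤ (w I) (𝟙-mono (p I) false (none I))

  -- Weighted count of the extensions of a fingerprint

  extC : ℕ → Subset n → Subset n → ℕ → ℕ
  extC z A X k = mixedC z (∣ A ─ X ∣) (∣ A ∩ X ∣) k

  -- Vertex by vertex, I is forced on S, free on A and empty elsewhere. Choices in A ─ X carry
  -- weight z and choices in A ∩ X weight 1, which is the recursion of `mixedC`.
  weighted-extensions : (z : ℕ) .{{_ : NonZero z}} (S A X : Subset n) (k : ℕ) (p : Subset n → Bool) → Disjoint S A →
    (∀ I → T (p I) → (S ⊆ I) × (I ⊆ S ∪ A) × (∣ I ∣ ≡ ∣ S ∣ + k)) →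
    sumSub (λ I → 𝟙 (p I) * z ^ ∣ I ─ X ∣) ≤ z ^ ∣ S ∣ * extC z A X k
  weighted-extensions z [] [] [] zero    p _ hyp with p []
  ... | true  = s≤s z≤n
  ... | false = z≤n
  weighted-extensions z [] [] [] (suc k) p _ hyp = sumSub-none p (λ I → z ^ ∣ I ─ [] ∣) _ none
    where
    none : ∀ I → ¬ T (p I)
    none [] t with () ← proj₂ (proj₂ (hyp [] t))
  weighted-extensions z (inside ∷ S) (inside ∷ A) X k p dis hyp = ⊥-elim (dis here here)
  weighted-extensions z (inside ∷ S) (outside ∷ A) (b ∷ X) k p dis hyp =
    +-mono-≤ (sumSub-none (p ∘ (outside ∷_)) _ 0 none)
    (begin
      sumSub (λ I → 𝟙 (p (inside ∷ I)) * z ^ ∣ (inside ∷ I) ─ (b ∷ X) ∣)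
        ≤⟨ sumSub-mono (λ I → ≤-trans (*-monoʳ-≤ (𝟙 (p (inside ∷ I))) (bump b I)) (≤-reflexive (eq (𝟙 (p (inside ∷ I))) z _))) ⟩
      sumSub (λ I → z * (𝟙 (p (inside ∷ I)) * z ^ ∣ I ─ X ∣))
        ≡⟨ sumSub-*ˡ z (λ I → 𝟙 (p (inside ∷ I)) * z ^ ∣ I ─ X ∣) ⟩
      z * sumSub (λ I → 𝟙 (p (inside ∷ I)) * z ^ ∣ I ─ X ∣)
        ≤⟨ *-monoʳ-≤ z (weighted-extensions z S A X k (p ∘ (inside ∷_)) (λ x∈S x∈A → dis (there x∈S) (there x∈A)) hyp′) ⟩
      z * (z ^ ∣ S ∣ * extC z A X k)
        ≡⟨ *-assoc z _ _ ⟨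
      z * z ^ ∣ S ∣ * extC z A X k
        ≡⟨ cong (z * z ^ ∣ S ∣ *_) (same b) ⟩
      z * z ^ ∣ S ∣ * extC z (outside ∷ A) (b ∷ X) k ∎)
    where
    none : ∀ I → ¬ T (p (outside ∷ I))
    none I t with () ← proj₁ (hyp (outside ∷ I) t) here
    bump : ∀ b I → z ^ ∣ (inside ∷ I) ─ (b ∷ X) ∣ ≤ z * z ^ ∣ I ─ X ∣
    -- An element of S inside X has weight 1 but is charged z as well, so that S enters only through
    -- |S|; this uses z ≥ 1.
    bump true  I = m≤n*m _ z
    bump false I = ≤-refl
    same : ∀ b → extC z A X k ≡ extC z (outside ∷ A) (b ∷ X) k
    same true  = refl
    same false = refl
    eq : ∀ a z w → a * (z * w) ≡ z * (a * w)
    eq = solve-∀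
    hyp′ : ∀ I → T (p (inside ∷ I)) → (S ⊆ I) × (I ⊆ S ∪ A) × (∣ I ∣ ≡ ∣ S ∣ + k)
    hyp′ I t with S⊆I , I⊆ , size ← hyp (inside ∷ I) t = drop-∷-⊆ S⊆I , drop-∷-⊆ I⊆ , suc-injective size
  weighted-extensions z (outside ∷ S) (outside ∷ A) (b ∷ X) k p dis hyp = begin
    sumSub (λ I → 𝟙 (p (outside ∷ I)) * z ^ ∣ (outside ∷ I) ─ (b ∷ X) ∣) + sumSub (λ I → 𝟙 (p (inside ∷ I)) * z ^ ∣ (inside ∷ I) ─ (b ∷ X) ∣)
      ≤⟨ +-mono-≤ (main b) (sumSub-none (p ∘ (inside ∷_)) _ 0 none) ⟩
    z ^ ∣ S ∣ * extC z (outside ∷ A) (b ∷ X) k + 0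
      ≡⟨ +-identityʳ _ ⟩
    z ^ ∣ S ∣ * extC z (outside ∷ A) (b ∷ X) k ∎
    where
    none : ∀ I → ¬ T (p (inside ∷ I))
    none I t with () ← proj₁ (proj₂ (hyp (inside ∷ I) t)) here
    hyp′ : ∀ I → T (p (outside ∷ I)) → (S ⊆ I) × (I ⊆ S ∪ A) × (∣ I ∣ ≡ ∣ S ∣ + k)
    hyp′ I t with S⊆I , I⊆ , size ← hyp (outside ∷ I) t = drop-∷-⊆ S⊆I , drop-∷-⊆ I⊆ , size
    ih = weighted-extensions z S A X k (p ∘ (outside ∷_)) (λ x∈S x∈A → dis (there x∈S) (there x∈A)) hyp′
    main : ∀ b → sumSub (λ I → 𝟙 (p (outside ∷ I)) * z ^ ∣ (outside ∷ I) ─ (b ∷ X) ∣) ≤ z ^ ∣ S ∣ * extC z (outside ∷ A) (b ∷ X) k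
    main true  = ih
    main false = ih
  weighted-extensions z (outside ∷ S) (inside ∷ A) (b ∷ X) k p dis hyp = main b k hyp
    where
    hyp-out : ∀ k → (∀ I → T (p I) → (outside ∷ S ⊆ I) × (I ⊆ inside ∷ S ∪ A) × (∣ I ∣ ≡ ∣ S ∣ + k)) →
              ∀ I → T (p (outside ∷ I)) → (S ⊆ I) × (I ⊆ S ∪ A) × (∣ I ∣ ≡ ∣ S ∣ + k)
    hyp-out k hyp I t with S⊆I , I⊆ , size ← hyp (outside ∷ I) t = drop-∷-⊆ S⊆I , drop-∷-⊆ I⊆ , size
    hyp-in : ∀ k → (∀ I → T (p I) → (outside ∷ S ⊆ I) × (I ⊆ inside ∷ S ∪ A) × (∣ I ∣ ≡ ∣ S ∣ + suc k)) →
              ∀ I → T (p (inside ∷ I)) → (S ⊆ I) × (I ⊆ S ∪ A) × (∣ I ∣ ≡ ∣ S ∣ + k)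
    hyp-in k hyp I t with S⊆I , I⊆ , size ← hyp (inside ∷ I) t =
      drop-∷-⊆ S⊆I , drop-∷-⊆ I⊆ , suc-injective (trans size (+-suc ∣ S ∣ k))
    -- With k = 0 the set I has exactly |S| elements, all taken up by S, so the current vertex of A
    -- cannot be added.
    none : (∀ I → T (p I) → (outside ∷ S ⊆ I) × (I ⊆ inside ∷ S ∪ A) × (∣ I ∣ ≡ ∣ S ∣ + 0)) →
           ∀ I → ¬ T (p (inside ∷ I))
    none hyp I t with S⊆I , _ , size ← hyp (inside ∷ I) t =
      1+n≰n (≤-trans (≤-reflexive (trans size (+-identityʳ ∣ S ∣))) (p⊆q⇒∣p∣≤∣q∣ (drop-∷-⊆ S⊆I)))
    dis′ : Disjoint S A
    dis′ x∈S x∈A = dis (there x∈S) (there x∈A)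
    y = ∣ A ─ X ∣
    x = ∣ A ∩ X ∣
    zs = z ^ ∣ S ∣
    eq : ∀ a z w → a * (z * w) ≡ z * (a * w)
    eq = solve-∀
    main : ∀ b k → (∀ I → T (p I) → (outside ∷ S ⊆ I) × (I ⊆ inside ∷ S ∪ A) × (∣ I ∣ ≡ ∣ S ∣ + k)) →
      sumSub (λ I → 𝟙 (p I) * z ^ ∣ I ─ (b ∷ X) ∣) ≤ zs * extC z (inside ∷ A) (b ∷ X) k
    main true zero hyp = begin
      _ ≤⟨ +-mono-≤ (weighted-extensions z S A X 0 (p ∘ (outside ∷_)) dis′ (hyp-out 0 hyp)) (sumSub-none (p ∘ (inside ∷_)) _ 0 (none hyp)) ⟩
      zs * mixedC z y x 0 + 0   ≡⟨ +-identityʳ _ ⟩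
      zs * mixedC z y x 0       ≡⟨ cong (zs *_) (trans (mixedC-zero z y x) (sym (mixedC-zero z y (suc x)))) ⟩
      zs * mixedC z y (suc x) 0 ∎
    main true (suc k) hyp = begin
      _ ≤⟨ +-mono-≤ (weighted-extensions z S A X (suc k) (p ∘ (outside ∷_)) dis′ (hyp-out (suc k) hyp))
                    (weighted-extensions z S A X k (p ∘ (inside ∷_)) dis′ (hyp-in k hyp)) ⟩
      zs * mixedC z y x (suc k) + zs * mixedC z y x k   ≡⟨ *-distribˡ-+ zs _ _ ⟨
      zs * (mixedC z y x (suc k) + mixedC z y x k)      ≡⟨ cong (zs *_) (mixedC-suc z y x k) ⟨
      zs * mixedC z y (suc x) (suc k)                   ∎
    main false zero hyp = begin
      _ ≤⟨ +-mono-≤ (weighted-extensions z S A X 0 (p ∘ (outside ∷_)) dis′ (hyp-out 0 hyp)) (sumSub-none (p ∘ (inside ∷_)) _ 0 (none hyp)) ⟩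
      zs * mixedC z y x 0 + 0   ≡⟨ +-identityʳ _ ⟩
      zs * mixedC z y x 0       ≡⟨ cong (zs *_) (mixedC-zero z y x) ⟩
      zs * 1                    ∎
    main false (suc k) hyp = begin
      _ ≤⟨ +-mono-≤ (weighted-extensions z S A X (suc k) (p ∘ (outside ∷_)) dis′ (hyp-out (suc k) hyp))
                    (≤-trans (≤-reflexive (trans (sumSub-cong (λ I → eq (𝟙 (p (inside ∷ I))) z (z ^ ∣ I ─ X ∣))) (sumSub-*ˡ z (λ I → 𝟙 (p (inside ∷ I)) * z ^ ∣ I ─ X ∣))))
                             (*-monoʳ-≤ z (weighted-extensions z S A X k (p ∘ (inside ∷_)) dis′ (hyp-in k hyp)))) ⟩
      zs * mixedC z y x (suc k) + z * (zs * mixedC z y x k)   ≡⟨ eq′ zs (mixedC z y x (suc k)) z (mixedC z y x k) ⟩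
      zs * (mixedC z y x (suc k) + z * mixedC z y x k)        ∎
      where
      eq′ : ∀ s a z b → s * a + z * (s * b) ≡ s * (a + z * b)
      eq′ = solve-∀

  -- Query trees and containers

  ∈─⁻ : (p q : Subset n) {x : Fin n} → x ∈ p ─ q → x ∉ q
  ∈─⁻ (_ ∷ p) (inside  ∷ q) (there x∈) (there x∈q) = ∈─⁻ p q x∈ x∈q
  ∈─⁻ (_ ∷ p) (outside ∷ q) (there x∈) (there x∈q) = ∈─⁻ p q x∈ x∈q

  -- The sets compatible with the answers so far: S consists of the positive answers, and A of the
  -- vertices still undecided.
  between : Subset n → Subset n → Subset n → Bool
  between S A I = ⌊ S ⊆? I ⌋ ∧ ⌊ I ⊆? S ∪ A ⌋

  between⁺ : (S A I : Subset n) → S ⊆ I → I ⊆ S ∪ A → T (between S A I)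
  between⁺ S A I S⊆I I⊆ = Equivalence.from T-∧ (fromWitness {a? = S ⊆? I} S⊆I , fromWitness {a? = I ⊆? S ∪ A} I⊆)

  between⁻ : (S A I : Subset n) → T (between S A I) → (S ⊆ I) × (I ⊆ S ∪ A)
  between⁻ S A I t with l , r ← Equivalence.to (T-∧ {⌊ S ⊆? I ⌋}) t =
    toWitness {a? = S ⊆? I} l , toWitness {a? = I ⊆? S ∪ A} r

  -- A query asks whether v belongs to the unknown independent set; a positive answer
  -- moves v from A to the fingerprint S and forbids the whole of Y.
  data QueryTree (Indep : Subset n → Set) (Leaf : Subset n → Subset n → Set) : Subset n → Subset n → Set where
    leaf  : ∀ {S A} → Leaf S A → QueryTree Indep Leaf S A
    query : ∀ {S A} (v : Fin n) (Y : Subset n) → v ∈ A → v ∉ S → v ∈ Y →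
            (∀ I → Indep I → v ∈ I → S ⊆ I → ∀ {x} → x ∈ Y → x ≢ v → x ∉ I) →
            QueryTree Indep Leaf S (A ─ ⁅ v ⁆) → QueryTree Indep Leaf (⁅ v ⁆ ∪ S) (A ─ Y) →
            QueryTree Indep Leaf S A

  module _ (Indep : Subset n → Set) (Leaf : Subset n → Subset n → Set)
           (q : Subset n → Bool) (q⇒indep : ∀ I → T (q I) → Indep I) where

    countBetween : Subset n → Subset n → ℕ
    countBetween S A = countSub (λ I → q I ∧ between S A I)

    countBetween-query : ∀ {S A} (v : Fin n) (Y : Subset n) →
      (∀ I → Indep I → v ∈ I → S ⊆ I → ∀ {x} → x ∈ Y → x ≢ v → x ∉ I) →
      countBetween S A ≤ countBetween S (A ─ ⁅ v ⁆) + countBetween (⁅ v ⁆ ∪ S) (A ─ Y)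
    countBetween-query {S} {A} v Y forbid = countSub-⊎
      (λ I → q I ∧ between S A I) (λ I → q I ∧ between S (A ─ ⁅ v ⁆) I) (λ I → q I ∧ between (⁅ v ⁆ ∪ S) (A ─ Y) I) split
      where
      split : ∀ I → T (q I ∧ between S A I) →
              T (q I ∧ between S (A ─ ⁅ v ⁆) I) ⊎ T (q I ∧ between (⁅ v ⁆ ∪ S) (A ─ Y) I)
      split I t with qI , b ← Equivalence.to (T-∧ {q I}) t
                with S⊆I , I⊆ ← between⁻ S A I b
                with v ∈? I
      ... | no v∉I = inj₁ (Equivalence.from T-∧ (qI , between⁺ S (A ─ ⁅ v ⁆) I S⊆I I⊆′))
        where
        I⊆′ : I ⊆ S ∪ (A ─ ⁅ v ⁆)
        I⊆′ {x} x∈I with x∈p∪q⁻ S A (I⊆ x∈I)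
        ... | inj₁ x∈S = x∈p∪q⁺ (inj₁ x∈S)
        ... | inj₂ x∈A = x∈p∪q⁺ (inj₂ (x∈p∧x∉q⇒x∈p─q x∈A (λ x∈v → v∉I (subst (_∈ I) (x∈⁅y⁆⇒x≡y v x∈v) x∈I))))
      ... | yes v∈I = inj₂ (Equivalence.from T-∧ (qI , between⁺ (⁅ v ⁆ ∪ S) (A ─ Y) I vS⊆I I⊆′))
        where
        vS⊆I : ⁅ v ⁆ ∪ S ⊆ I
        vS⊆I {x} x∈ with x∈p∪q⁻ ⁅ v ⁆ S x∈
        ... | inj₁ x∈v = subst (_∈ I) (sym (x∈⁅y⁆⇒x≡y v x∈v)) v∈I
        ... | inj₂ x∈S = S⊆I x∈S
        I⊆′ : I ⊆ (⁅ v ⁆ ∪ S) ∪ (A ─ Y)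
        I⊆′ {x} x∈I with x∈p∪q⁻ S A (I⊆ x∈I) | x ∈? ⁅ v ⁆ | x ∈? Y
        ... | inj₁ x∈S | _       | _       = x∈p∪q⁺ (inj₁ (x∈p∪q⁺ (inj₂ x∈S)))
        ... | inj₂ _   | yes x∈v | _       = x∈p∪q⁺ (inj₁ (x∈p∪q⁺ (inj₁ x∈v)))
        ... | inj₂ x∈A | no _    | no x∉Y  = x∈p∪q⁺ (inj₂ (x∈p∧x∉q⇒x∈p─q x∈A x∉Y))
        ... | inj₂ _   | no x∉v  | yes x∈Y = ⊥-elim (forbid I (q⇒indep I qI) v∈I S⊆I x∈Y (λ { refl → x∉v (x∈⁅x⁆ v) }) x∈I)

    -- Weighting a fingerprint S by (m/u)^|S| turns the sum over all leaves into (1 + m/u)^|A|.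
    countBetween-bound : (P M u m : ℕ) →
      (∀ S A → Leaf S A → P * (countBetween S A * u ^ ∣ S ∣) ≤ M * m ^ ∣ S ∣) →
      ∀ {S A} → QueryTree Indep Leaf S A → ∀ a → ∣ A ∣ ≤ a →
      P * (countBetween S A * u ^ (∣ S ∣ + a)) ≤ M * m ^ ∣ S ∣ * (u + m) ^ a
    countBetween-bound P M u m leaf-bound {S} {A} (leaf l) a _ = begin
      P * (countBetween S A * u ^ (∣ S ∣ + a))             ≡⟨ cong (λ y → P * (countBetween S A * y)) (^-distribˡ-+-* u (∣ S ∣) a) ⟩
      P * (countBetween S A * (u ^ ∣ S ∣ * u ^ a))         ≡⟨ eq P (countBetween S A) (u ^ ∣ S ∣) (u ^ a) ⟩
      P * (countBetween S A * u ^ ∣ S ∣) * u ^ a           ≤⟨ *-mono-≤ (leaf-bound S A l) (^-monoˡ-≤ a (m≤m+n u m)) ⟩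
      M * m ^ ∣ S ∣ * (u + m) ^ a                          ∎
      where
      eq : ∀ p c x y → p * (c * (x * y)) ≡ p * (c * x) * y
      eq = solve-∀
    countBetween-bound P M u m leaf-bound (query v Y v∈A v∉S v∈Y forbid t₀ t₁) zero a<
      with () ← ≤-trans (x∈p⇒∣p-x∣<∣p∣ v∈A) a<
    countBetween-bound P M u m leaf-bound {S} {A} (query v Y v∈A v∉S v∈Y forbid t₀ t₁) (suc a) ∣A∣≤ = begin
      P * (countBetween S A * u ^ (s + suc a))
        ≤⟨ *-monoʳ-≤ P (*-monoˡ-≤ (u ^ (s + suc a)) (countBetween-query v Y forbid)) ⟩
      P * ((c₀ + c₁) * u ^ (s + suc a))
        ≡⟨ cong (λ j → P * ((c₀ + c₁) * u ^ j)) (+-suc s a) ⟩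
      P * ((c₀ + c₁) * (u * u ^ (s + a)))
        ≡⟨ eq₁ P c₀ c₁ u (u ^ (s + a)) ⟩
      u * (P * (c₀ * u ^ (s + a))) + P * (c₁ * (u ^ (suc s + a)))
        ≤⟨ +-mono-≤ (*-monoʳ-≤ u (countBetween-bound P M u m leaf-bound t₀ a a₀≤)) right ⟩
      u * (M * m ^ s * (u + m) ^ a) + M * m ^ suc s * (u + m) ^ a
        ≡⟨ eq₂ u M (m ^ s) ((u + m) ^ a) m ⟩
      M * m ^ s * (u + m) ^ suc a ∎
      where
      s = ∣ S ∣
      c₀ = countBetween S (A ─ ⁅ v ⁆)
      c₁ = countBetween (⁅ v ⁆ ∪ S) (A ─ Y)
      a₀≤ : ∣ A ─ ⁅ v ⁆ ∣ ≤ a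
      a₀≤ = s≤s⁻¹ (≤-trans (x∈p⇒∣p-x∣<∣p∣ v∈A) ∣A∣≤)
      a₁≤ : ∣ A ─ Y ∣ ≤ a
      a₁≤ = s≤s⁻¹ (≤-trans (p∩q≢∅⇒∣p─q∣<∣p∣ A Y (v , x∈p∩q⁺ (v∈A , v∈Y))) ∣A∣≤)
      right : P * (c₁ * u ^ (suc s + a)) ≤ M * m ^ suc s * (u + m) ^ a
      right = subst (λ j → P * (c₁ * u ^ (j + a)) ≤ M * m ^ j * (u + m) ^ a) (∣⁅⁆∪∣ S v v∉S)
                    (countBetween-bound P M u m leaf-bound t₁ a a₁≤)
      eq₁ : ∀ p c d u w → p * ((c + d) * (u * w)) ≡ u * (p * (c * w)) + p * (d * (u * w))
      eq₁ = solve-∀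
      eq₂ : ∀ u M w y m → u * (M * w * y) + M * (m * w) * y ≡ M * w * ((u + m) * y)
      eq₂ = solve-∀

    countSub≤countBetween : countSub q ≤ countBetween ⊥ ⊤
    countSub≤countBetween = countSub-mono q (λ I → q I ∧ between ⊥ ⊤ I)
      (λ I qI → Equivalence.from (T-∧ {q I}) (qI , between⁺ ⊥ ⊤ I ⊥⊆ (subst (I ⊆_) (sym (∪-identityˡ ⊤)) ⊆⊤)))

  -- The query tree of a 3-graph with bounded codegrees

  module Container {n : ℕ} (K d c : ℕ) (h : Fin n → Fin n → Fin n → ℕ)
    (h-sym₁₂ : ∀ x y z → h x y z ≡ h y x z) (h-sym₂₃ : ∀ x y z → h x y z ≡ h x z y)
    (h-codeg : ∀ x y A → sumOn A (h x y) ≤ K) where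

    -- A vertex joins F only while all link degrees are at most d, and its link adds at most K at
    -- any vertex.
    D : ℕ
    D = d + K

    -- the degree of u, and the total degree, in the multigraph on A formed by the links of the vertices of F
    linkDeg : Subset n → Subset n → Fin n → ℕ
    linkDeg F A u = sumOn F (λ s → sumOn A (h s u))

    linkSum : Subset n → Subset n → ℕ
    linkSum F A = sumOn A (linkDeg F A)

    deg : Subset n → Fin n → ℕ
    deg A v = sumOn A (λ x → sumOn A (h v x))

    Indep : Subset n → Set
    Indep I = ∀ {x y z} → x ∈ I → y ∈ I → z ∈ I → h x y z ≡ 0

    -- All that the counting needs of a leaf: the ordered triples of h inside A are few, and S
    -- splits into two kinds of vertices with one budget each.
    Leaf : Subset n → Subset n → Set
    Leaf S A = Disjoint S A × sumOn A (deg A) ≤ n * c ×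
               ∃[ p ] ∃[ q ] (∣ S ∣ ≡ p + q × p * c ≤ 2 * D * n × q * d ≤ K * n)

    linkDeg-mono : ∀ F A B u → A ⊆ B → linkDeg F A u ≤ linkDeg F B u
    linkDeg-mono F A B u A⊆B = sumOn-mono F (λ s _ → sumOn-⊆ A B (h s u) A⊆B)

    linkDeg-split : ∀ F A Y u → linkDeg F A u ≡ linkDeg F (A ─ Y) u + linkDeg F (A ∩ Y) u
    linkDeg-split F A Y u = trans (sumOn-cong F (λ s → sumOn-split A Y (h s u))) (sumOn-+ F _ _)

    linkDeg-swap : ∀ F A B → sumOn A (linkDeg F B) ≡ sumOn B (linkDeg F A)
    linkDeg-swap F A B = begin-equality
      sumOn A (λ u → sumOn F (λ s → sumOn B (h s u)))            ≡⟨ sumOn-swap A F _ ⟩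
      sumOn F (λ s → sumOn A (λ u → sumOn B (h s u)))            ≡⟨ sumOn-cong F (λ s → sumOn-swap A B (h s)) ⟩
      sumOn F (λ s → sumOn B (λ x → sumOn A (λ u → h s u x)))    ≡⟨ sumOn-cong F (λ s → sumOn-cong B (λ x → sumOn-cong A (λ u → h-sym₂₃ s u x))) ⟩
      sumOn F (λ s → sumOn B (λ x → sumOn A (h s x)))            ≡⟨ sumOn-swap F B _ ⟩
      sumOn B (linkDeg F A)                                      ∎

    -- An incidence is lost when either of its ends is deleted. By `linkDeg-swap` both ends account
    -- for the same number of losses, at most D per deleted vertex; hence the factor 2.
    linkSum-removal : ∀ F A Y → (∀ u → u ∈ A → linkDeg F A u ≤ D) →
                      linkSum F A ≤ linkSum F (A ─ Y) + 2 * D * ∣ A ∩ Y ∣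
    linkSum-removal F A Y deg≤D = begin
      sumOn A (linkDeg F A)                                               ≡⟨ sumOn-split A Y _ ⟩
      sumOn A′ (linkDeg F A) + sumOn R (linkDeg F A)                      ≡⟨ cong (_+ sumOn R (linkDeg F A)) (trans (sumOn-cong A′ (linkDeg-split F A Y)) (sumOn-+ A′ _ _)) ⟩
      linkSum F A′ + sumOn A′ (linkDeg F R) + sumOn R (linkDeg F A)       ≤⟨ +-monoˡ-≤ _ (+-monoʳ-≤ (linkSum F A′) (sumOn-⊆ A′ A (linkDeg F R) (p─q⊆p A Y))) ⟩
      linkSum F A′ + sumOn A (linkDeg F R) + sumOn R (linkDeg F A)        ≡⟨ cong (λ j → linkSum F A′ + j + sumOn R (linkDeg F A)) (linkDeg-swap F A R) ⟩
      linkSum F A′ + sumOn R (linkDeg F A) + sumOn R (linkDeg F A)        ≤⟨ +-mono-≤ (+-monoʳ-≤ (linkSum F A′) few) few ⟩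
      linkSum F A′ + ∣ R ∣ * D + ∣ R ∣ * D                                ≡⟨ eq (linkSum F A′) (∣ R ∣) D ⟩
      linkSum F A′ + 2 * D * ∣ R ∣                                        ∎
      where
      A′ = A ─ Y
      R = A ∩ Y
      few : sumOn R (linkDeg F A) ≤ ∣ R ∣ * D
      few = sumOn-≤ R D (λ u u∈R → deg≤D u (p∩q⊆p A Y u∈R))
      eq : ∀ w r D → w + r * D + r * D ≡ w + 2 * D * r
      eq = solve-∀

    linkDeg-insert : ∀ F A v u → v ∉ F → linkDeg (⁅ v ⁆ ∪ F) A u ≡ sumOn A (h v u) + linkDeg F A u
    linkDeg-insert F A v u v∉F = sumOn-⁅⁆∪ F v (λ s → sumOn A (h s u)) v∉F

    linkSum-insert : ∀ F A v → v ∉ F → linkSum (⁅ v ⁆ ∪ F) A ≡ deg A v + linkSum F A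
    linkSum-insert F A v v∉F = trans (sumOn-cong A (λ u → linkDeg-insert F A v u v∉F)) (sumOn-+ A _ _)

    linkNbhd : Subset n → Fin n → Subset n
    linkNbhd F v = tabulate (λ x → ⌊ 1 ≤? sumOn F (λ s → h s v x) ⌋)

    ∈-linkNbhd⁻ : ∀ F v x → x ∈ linkNbhd F v → 1 ≤ sumOn F (λ s → h s v x)
    ∈-linkNbhd⁻ F v x x∈ = toWitness {a? = 1 ≤? _}
      (Equivalence.from T-≡ (trans (sym (Vec.lookup∘tabulate _ x)) (Vec.[]=⇒lookup x∈)))

    ∉-linkNbhd⁻ : ∀ F v x → x ∉ linkNbhd F v → sumOn F (λ s → h s v x) ≡ 0
    ∉-linkNbhd⁻ F v x x∉ = n<1⇒n≡0 (≰⇒> λ 1≤ → x∉ (Vec.lookup⇒[]= x _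
      (trans (Vec.lookup∘tabulate _ x) (Equivalence.to T-≡ (fromWitness {a? = 1 ≤? _} 1≤)))))

    -- A pair v, x has multiplicity at most K in the link multigraph, because that multiplicity
    -- counts edges through v and x. A vertex of degree d therefore has at least d/K distinct
    -- neighbours.
    linkNbhd-large : ∀ F A Y v → linkNbhd F v ⊆ Y → linkDeg F A v ≤ K * ∣ A ∩ Y ∣
    linkNbhd-large F A Y v N⊆Y = begin
      sumOn F (λ s → sumOn A (h s v))                 ≡⟨ sumOn-swap F A _ ⟩
      sumOn A w                                       ≡⟨ sumOn-split A Y w ⟩
      sumOn (A ─ Y) w + sumOn (A ∩ Y) w               ≡⟨ cong (_+ sumOn (A ∩ Y) w) (sumOn-0 (A ─ Y) (λ x x∈ → ∉-linkNbhd⁻ F v x (∈─⁻ A Y x∈ ∘ N⊆Y))) ⟩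
      sumOn (A ∩ Y) w                                 ≤⟨ sumOn-≤ (A ∩ Y) K (λ x _ → ≤-trans (≤-reflexive (sumOn-cong F (λ s → trans (h-sym₁₂ s v x) (h-sym₂₃ v s x)))) (h-codeg v x F)) ⟩
      ∣ A ∩ Y ∣ * K                                   ≡⟨ *-comm (∣ A ∩ Y ∣) K ⟩
      K * ∣ A ∩ Y ∣                                   ∎
      where
      w : Fin n → ℕ
      w x = sumOn F (λ s → h s v x)

    -- F collects the fingerprint vertices queried for their degree in h (p of them); the
    -- other q were queried for their degree in the link multigraph of F.
    record State (S F A : Subset n) : Set where
      field
        p q      : ℕ
        F⊆S      : F ⊆ S
        disjoint : Disjoint S A
        size     : ∣ S ∣ ≡ p + q
        deg≤D    : ∀ u → u ∈ A → linkDeg F A u ≤ D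
        p-budget : p * c + 2 * D * ∣ A ∣ ≤ linkSum F A + 2 * D * n
        q-budget : q * d + K * ∣ A ∣ ≤ K * n

    -- Both budgets are potentials. Deletion may destroy incidences of the multigraph, but at most
    -- 2D per vertex, which is exactly what `2 * D * ∣ A ∣` gives back; the second budget only gains
    -- when A shrinks.
    remove : ∀ {S F A} (Y : Subset n) → State S F A → State S F (A ─ Y)
    remove {S} {F} {A} Y st = record
      { p = p ; q = q ; F⊆S = F⊆S ; size = size
      ; disjoint = λ x∈S x∈A─Y → disjoint x∈S (p─q⊆p A Y x∈A─Y)
      ; deg≤D = λ u u∈ → ≤-trans (linkDeg-mono F (A ─ Y) A u (p─q⊆p A Y)) (deg≤D u (p─q⊆p A Y u∈))
      ; p-budget = +-cancelʳ-≤ (2 * D * ∣ A ∩ Y ∣) _ _ (begin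
          p * c + 2 * D * ∣ A ─ Y ∣ + 2 * D * ∣ A ∩ Y ∣      ≡⟨ eq (p * c) (2 * D) (∣ A ─ Y ∣) (∣ A ∩ Y ∣) ⟩
          p * c + 2 * D * (∣ A ─ Y ∣ + ∣ A ∩ Y ∣)            ≡⟨ cong (λ j → p * c + 2 * D * j) (∣∣-split A Y) ⟨
          p * c + 2 * D * ∣ A ∣                              ≤⟨ p-budget ⟩
          linkSum F A + 2 * D * n                            ≤⟨ +-monoˡ-≤ _ (linkSum-removal F A Y deg≤D) ⟩
          linkSum F (A ─ Y) + 2 * D * ∣ A ∩ Y ∣ + 2 * D * n  ≡⟨ eq′ (linkSum F (A ─ Y)) (2 * D * ∣ A ∩ Y ∣) (2 * D * n) ⟩
          linkSum F (A ─ Y) + 2 * D * n + 2 * D * ∣ A ∩ Y ∣  ∎)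
      ; q-budget = ≤-trans (+-monoʳ-≤ (q * d) (*-monoʳ-≤ K (∣p─q∣≤∣p∣ A Y))) q-budget
      }
      where
      open State st
      eq : ∀ a b x y → a + b * x + b * y ≡ a + b * (x + y)
      eq = solve-∀
      eq′ : ∀ a b e → a + b + e ≡ a + e + b
      eq′ = solve-∀

    insert-disjoint : ∀ {S A Y : Subset n} {v} → v ∈ Y → Disjoint S A → Disjoint (⁅ v ⁆ ∪ S) (A ─ Y)
    insert-disjoint {S} {A} {Y} {v} v∈Y dis x∈ x∈A─Y with x∈p∪q⁻ ⁅ v ⁆ S x∈
    ... | inj₁ x∈v = ∈─⁻ A Y x∈A─Y (subst (_∈ Y) (sym (x∈⁅y⁆⇒x≡y v x∈v)) v∈Y)
    ... | inj₂ x∈S = dis x∈S (p─q⊆p A Y x∈A─Y)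

    -- The link of v brings `deg A v` ≥ c new incidences, which pays for raising p by one. This is
    -- the only step that raises link degrees, so it demands that they be at most d beforehand.
    pick-by-degree : ∀ {S F A v} (st : State S F A) → v ∈ A → (∀ u → u ∈ A → linkDeg F A u ≤ d) → c ≤ deg A v →
                     State (⁅ v ⁆ ∪ S) (⁅ v ⁆ ∪ F) (A ─ ⁅ v ⁆)
    pick-by-degree {S} {F} {A} {v} st v∈A deg≤d c≤deg = record
      { p = suc p ; q = q
      ; F⊆S = λ x∈ → x∈p∪q⁺ ([ inj₁ , inj₂ ∘ F⊆S ]′ (x∈p∪q⁻ ⁅ v ⁆ F x∈))
      ; disjoint = insert-disjoint (x∈⁅x⁆ v) disjoint
      ; size = trans (∣⁅⁆∪∣ S v v∉S) (cong suc size)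
      ; deg≤D = λ u u∈ → ≤-trans (linkDeg-mono F′ (A ─ ⁅ v ⁆) A u A′⊆A) (deg≤D′ u (A′⊆A u∈))
      ; p-budget = +-cancelʳ-≤ (2 * D * ∣ A ∩ ⁅ v ⁆ ∣) _ _ (begin
          suc p * c + 2 * D * ∣ A ─ ⁅ v ⁆ ∣ + 2 * D * ∣ A ∩ ⁅ v ⁆ ∣      ≡⟨ eq (suc p * c) (2 * D) (∣ A ─ ⁅ v ⁆ ∣) (∣ A ∩ ⁅ v ⁆ ∣) ⟩
          suc p * c + 2 * D * (∣ A ─ ⁅ v ⁆ ∣ + ∣ A ∩ ⁅ v ⁆ ∣)            ≡⟨ cong (λ j → suc p * c + 2 * D * j) (∣∣-split A ⁅ v ⁆) ⟨
          suc p * c + 2 * D * ∣ A ∣                                      ≡⟨ +-assoc c (p * c) _ ⟩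
          c + (p * c + 2 * D * ∣ A ∣)                                    ≤⟨ +-mono-≤ c≤deg p-budget ⟩
          deg A v + (linkSum F A + 2 * D * n)                            ≡⟨ +-assoc (deg A v) _ _ ⟨
          deg A v + linkSum F A + 2 * D * n                              ≡⟨ cong (_+ 2 * D * n) (linkSum-insert F A v v∉F) ⟨
          linkSum F′ A + 2 * D * n                                       ≤⟨ +-monoˡ-≤ _ (linkSum-removal F′ A ⁅ v ⁆ deg≤D′) ⟩
          linkSum F′ (A ─ ⁅ v ⁆) + 2 * D * ∣ A ∩ ⁅ v ⁆ ∣ + 2 * D * n     ≡⟨ eq′ (linkSum F′ (A ─ ⁅ v ⁆)) (2 * D * ∣ A ∩ ⁅ v ⁆ ∣) (2 * D * n) ⟩
          linkSum F′ (A ─ ⁅ v ⁆) + 2 * D * n + 2 * D * ∣ A ∩ ⁅ v ⁆ ∣     ∎)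
      ; q-budget = ≤-trans (+-monoʳ-≤ (q * d) (*-monoʳ-≤ K (∣p─q∣≤∣p∣ A ⁅ v ⁆))) q-budget
      }
      where
      open State st hiding (deg≤D)
      F′ = ⁅ v ⁆ ∪ F
      A′⊆A : A ─ ⁅ v ⁆ ⊆ A
      A′⊆A = p─q⊆p A ⁅ v ⁆
      v∉S : v ∉ S
      v∉S v∈S = disjoint v∈S v∈A
      v∉F : v ∉ F
      v∉F = v∉S ∘ F⊆S
      deg≤D′ : ∀ u → u ∈ A → linkDeg F′ A u ≤ D
      deg≤D′ u u∈A = begin
        linkDeg F′ A u                     ≡⟨ linkDeg-insert F A v u v∉F ⟩
        sumOn A (h v u) + linkDeg F A u    ≤⟨ +-mono-≤ (h-codeg v u A) (deg≤d u u∈A) ⟩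
        K + d                              ≡⟨ +-comm K d ⟩
        D                                  ∎
      eq : ∀ a b x y → a + b * x + b * y ≡ a + b * (x + y)
      eq = solve-∀
      eq′ : ∀ a b e → a + b + e ≡ a + e + b
      eq′ = solve-∀

    -- Since A loses at least d/K vertices, `K * ∣ A ∣` falls by at least d and pays for raising q
    -- by one. The vertex joins S but not F, so the multigraph gets no new edges.
    pick-by-link : ∀ {S F A v} (Y : Subset n) (st : State S F A) → v ∈ A → v ∈ Y → linkNbhd F v ⊆ Y → d ≤ linkDeg F A v →
                   State (⁅ v ⁆ ∪ S) F (A ─ Y)
    pick-by-link {S} {F} {A} {v} Y st v∈A v∈Y N⊆Y d≤ = record
      { p = p ; q = suc q
      ; F⊆S = λ x∈ → x∈p∪q⁺ (inj₂ (F⊆S x∈))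
      ; disjoint = insert-disjoint v∈Y disjoint
      ; size = trans (∣⁅⁆∪∣ S v (λ v∈S → disjoint v∈S v∈A)) (trans (cong suc size) (sym (+-suc p q)))
      ; deg≤D = State.deg≤D (remove Y st)
      ; p-budget = State.p-budget (remove Y st)
      ; q-budget = begin
          suc q * d + K * ∣ A ─ Y ∣                        ≡⟨ +-assoc d (q * d) _ ⟩
          d + (q * d + K * ∣ A ─ Y ∣)                      ≤⟨ +-monoˡ-≤ _ (≤-trans d≤ (linkNbhd-large F A Y v N⊆Y)) ⟩
          K * ∣ A ∩ Y ∣ + (q * d + K * ∣ A ─ Y ∣)          ≡⟨ eq K (∣ A ∩ Y ∣) (q * d) (∣ A ─ Y ∣) ⟩
          q * d + K * (∣ A ─ Y ∣ + ∣ A ∩ Y ∣)              ≡⟨ cong (λ j → q * d + K * j) (∣∣-split A Y) ⟨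
          q * d + K * ∣ A ∣                                ≤⟨ q-budget ⟩
          K * n                                            ∎
      }
      where
      open State st
      eq : ∀ K a b e → K * a + (b + K * e) ≡ b + K * (e + a)
      eq = solve-∀

    state⇒leaf : ∀ {S F A} → State S F A → (∀ v → v ∈ A → deg A v ≤ c) → Leaf S A
    state⇒leaf {S} {F} {A} st deg≤c =
      disjoint , ≤-trans (sumOn-≤ A c deg≤c) (*-monoˡ-≤ c (∣p∣≤n A)) ,
      p , q , size ,
      -- At the end `linkSum F A` is at most D |A|, half of the term `2 * D * ∣ A ∣` on the other
      -- side of the budget.
      +-cancelʳ-≤ (2 * D * ∣ A ∣) _ _ (begin
        p * c + 2 * D * ∣ A ∣              ≤⟨ p-budget ⟩
        linkSum F A + 2 * D * n            ≤⟨ +-monoˡ-≤ _ (sumOn-≤ A D deg≤D) ⟩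
        ∣ A ∣ * D + 2 * D * n              ≤⟨ m≤m+n _ (∣ A ∣ * D) ⟩
        ∣ A ∣ * D + 2 * D * n + ∣ A ∣ * D  ≡⟨ eq (∣ A ∣) D (2 * D * n) ⟩
        2 * D * n + 2 * D * ∣ A ∣          ∎) ,
      ≤-trans (m≤m+n (q * d) _) q-budget
      where
      open State st
      eq : ∀ a D b → a * D + b + a * D ≡ b + 2 * D * a
      eq = solve-∀

    -- The bound k on |A| drives the recursion, as both answers delete at least v. The link test has
    -- priority: its failure is the hypothesis of `pick-by-degree`.
    build : ∀ k {S F A} → ∣ A ∣ ≤ k → State S F A → QueryTree Indep Leaf S A
    build k {S} {F} {A} ∣A∣≤k st
      with any? (λ v → (v ∈? A) ×-dec (d ≤? linkDeg F A v)) | any? (λ v → (v ∈? A) ×-dec (c ≤? deg A v))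
    build zero ∣A∣≤0 st | yes (v , v∈A , _) | _ with () ← ≤-trans (x∈p⇒∣p-x∣<∣p∣ v∈A) ∣A∣≤0
    build zero ∣A∣≤0 st | no _ | yes (v , v∈A , _) with () ← ≤-trans (x∈p⇒∣p-x∣<∣p∣ v∈A) ∣A∣≤0
    build (suc k) {S} {F} {A} ∣A∣≤k st | yes (v , v∈A , d≤) | _ =
      query v Y v∈A (λ v∈S → disjoint v∈S v∈A) v∈Y forbid
        (build k (s≤s⁻¹ (≤-trans (x∈p⇒∣p-x∣<∣p∣ v∈A) ∣A∣≤k)) (remove ⁅ v ⁆ st))
        (build k (s≤s⁻¹ (≤-trans (p∩q≢∅⇒∣p─q∣<∣p∣ A Y (v , x∈p∩q⁺ (v∈A , v∈Y))) ∣A∣≤k))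
                 (pick-by-link Y st v∈A v∈Y (q⊆p∪q ⁅ v ⁆ (linkNbhd F v)) d≤))
      where
      open State st
      Y = ⁅ v ⁆ ∪ linkNbhd F v
      v∈Y : v ∈ Y
      v∈Y = x∈p∪q⁺ (inj₁ (x∈⁅x⁆ v))
      forbid : ∀ I → Indep I → v ∈ I → S ⊆ I → ∀ {x} → x ∈ Y → x ≢ v → x ∉ I
      forbid I ind v∈I S⊆I {x} x∈Y x≢v x∈I with x∈p∪q⁻ ⁅ v ⁆ (linkNbhd F v) x∈Y
      ... | inj₁ x∈v = x≢v (x∈⁅y⁆⇒x≡y v x∈v)
      -- A neighbour x of v comes from some s in F ⊆ S ⊆ I with h s v x positive, so s, v and x
      -- cannot all lie in the independent set I.
      ... | inj₂ x∈N with () ← ≤-trans (∈-linkNbhd⁻ F v x x∈N) (≤-reflexive (sumOn-0 F (λ s s∈F → ind (S⊆I (F⊆S s∈F)) v∈I x∈I)))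
    build (suc k) {S} {F} {A} ∣A∣≤k st | no ¬link | yes (v , v∈A , c≤) =
      query v ⁅ v ⁆ v∈A (λ v∈S → State.disjoint st v∈S v∈A) (x∈⁅x⁆ v)
        (λ I _ _ _ x∈v x≢v _ → x≢v (x∈⁅y⁆⇒x≡y v x∈v))
        (build k ∣A′∣≤k (remove ⁅ v ⁆ st))
        (build k ∣A′∣≤k (pick-by-degree st v∈A (λ u u∈A → <⇒≤ (≰⇒> λ d≤ → ¬link (u , u∈A , d≤))) c≤))
      where
      ∣A′∣≤k : ∣ A ─ ⁅ v ⁆ ∣ ≤ k
      ∣A′∣≤k = s≤s⁻¹ (≤-trans (x∈p⇒∣p-x∣<∣p∣ v∈A) ∣A∣≤k)
    build k st≤ st | no _ | no ¬deg = leaf (state⇒leaf st (λ v v∈A → <⇒≤ (≰⇒> λ c≤ → ¬deg (v , v∈A , c≤))))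

    queryTree : QueryTree Indep Leaf ⊥ ⊤
    queryTree = build n (∣p∣≤n ⊤) (record
      { p = 0 ; q = 0
      ; F⊆S = λ x∈ → x∈
      ; disjoint = λ x∈⊥ _ → ∉⊥ x∈⊥
      ; size = ∣⊥∣≡0 n
      ; deg≤D = λ u _ → ≤-trans (≤-reflexive (emptySum n (λ s → sumOn ⊤ (h s u)))) z≤n
      ; p-budget = ≤-trans (*-monoʳ-≤ (2 * D) (∣p∣≤n (⊤ {n}))) (m≤n+m _ (linkSum ⊥ ⊤))
      ; q-budget = *-monoʳ-≤ K (∣p∣≤n (⊤ {n}))
      })
      where
      emptySum : ∀ n (f : Fin n → ℕ) → sumOn ⊥ f ≡ 0
      emptySum n f = sumOn-0 (⊥ {n}) (λ x x∈⊥ → ⊥-elim (∉⊥ x∈⊥))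

  -- Hypergraphs as ternary functions

  ∈-allSubsets : (X : Subset n) → X ∈ˡ allSubsets n
  ∈-allSubsets []            = here refl
  ∈-allSubsets (outside ∷ X) = ∈-++⁺ˡ (∈-map⁺ (outside ∷_) (∈-allSubsets X))
  ∈-allSubsets (inside  ∷ X) = ∈-++⁺ʳ _ (∈-map⁺ (inside ∷_) (∈-allSubsets X))

  allᵇ⁻ : {A : Set} (p : A → Bool) (xs : List A) → T (allᵇ p xs) → ∀ {x} → x ∈ˡ xs → T (p x)
  allᵇ⁻ p (y ∷ xs) t (here refl) = proj₁ (Equivalence.to (T-∧ {p y}) t)
  allᵇ⁻ p (y ∷ xs) t (there x∈)  = allᵇ⁻ p xs (proj₂ (Equivalence.to (T-∧ {p y}) t)) x∈

  foldr-⊔-upper : ∀ (xs : List ℕ) {x} → x ∈ˡ xs → x ≤ List.foldr _⊔_ 0 xs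
  foldr-⊔-upper (y ∷ xs) (here refl) = m≤m⊔n y _
  foldr-⊔-upper (y ∷ xs) (there x∈)  = ≤-trans (foldr-⊔-upper xs x∈) (m≤n⊔m y _)

  foldr-⊔-least : ∀ (xs : List ℕ) k → (∀ {x} → x ∈ˡ xs → x ≤ k) → List.foldr _⊔_ 0 xs ≤ k
  foldr-⊔-least []       k _  = z≤n
  foldr-⊔-least (y ∷ xs) k ub = ⊔-lub (ub (here refl)) (foldr-⊔-least xs k (ub ∘ there))

  ∣∣≤norm : (B : Family n) (X : Subset n) → T (B X) → ∣ X ∣ ≤ norm B
  ∣∣≤norm B X BX = foldr-⊔-upper _ (∈-map⁺ ∣_∣ (∈-filter⁺ (T? ∘ B) (∈-allSubsets X) BX))

  norm≤n : (B : Family n) → norm B ≤ n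
  norm≤n {n} B = foldr-⊔-least _ n bound
    where
    bound : ∀ {x} → x ∈ˡ List.map ∣_∣ (filterᵇ B (allSubsets n)) → x ≤ n
    bound x∈ with X , _ , refl ← ∈-map⁻ ∣_∣ x∈ = ∣p∣≤n X

  ∣∪∣≤ : (p q : Subset n) → ∣ p ∪ q ∣ ≤ ∣ p ∣ + ∣ q ∣
  ∣∪∣≤ []            []            = z≤n
  ∣∪∣≤ (outside ∷ p) (outside ∷ q) = ∣∪∣≤ p q
  ∣∪∣≤ (outside ∷ p) (inside  ∷ q) = ≤-trans (s≤s (∣∪∣≤ p q)) (≤-reflexive (sym (+-suc ∣ p ∣ ∣ q ∣)))
  ∣∪∣≤ (inside  ∷ p) (outside ∷ q) = s≤s (∣∪∣≤ p q)
  ∣∪∣≤ (inside  ∷ p) (inside  ∷ q) = s≤s (≤-trans (∣∪∣≤ p q) (+-monoʳ-≤ ∣ p ∣ (n≤1+n ∣ q ∣)))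

  sumSub-member : (f : Subset n → ℕ) (I : Subset n) → f I ≤ sumSub f
  sumSub-member f []            = ≤-refl
  sumSub-member f (outside ∷ I) = m≤n⇒m≤n+o _ (sumSub-member (f ∘ (outside ∷_)) I)
  sumSub-member f (inside  ∷ I) = m≤n⇒m≤o+n _ (sumSub-member (f ∘ (inside ∷_)) I)

  sumSub-unique : (p : Subset n → Bool) (t : Subset n) → (∀ I → T (p I) → I ≡ t) → sumSub (𝟙 ∘ p) ≤ 1
  sumSub-unique p [] _ with p []
  ... | true  = ≤-refl
  ... | false = z≤n
  sumSub-unique {suc n} p (outside ∷ t) uniq = +-mono-≤
    (sumSub-unique (p ∘ (outside ∷_)) t (λ I pI → Vec.∷-injectiveʳ (uniq _ pI)))
    (≤-reflexive (trans (sym (countSub≡sumSub (p ∘ (inside ∷_))))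
                        (countSub-none (p ∘ (inside ∷_)) (λ I pI → case (uniq _ pI)))))
    where
    case : ∀ {I : Subset n} → inside ∷ I ≢ outside ∷ t
    case ()
  sumSub-unique {suc n} p (inside ∷ t) uniq = +-mono-≤ {_} {0}
    (≤-reflexive (trans (sym (countSub≡sumSub (p ∘ (outside ∷_))))
                        (countSub-none (p ∘ (outside ∷_)) (λ I pI → case (uniq _ pI)))))
    (sumSub-unique (p ∘ (inside ∷_)) t (λ I pI → Vec.∷-injectiveʳ (uniq _ pI)))
    where
    case : ∀ {I : Subset n} → outside ∷ I ≢ inside ∷ t
    case ()

  sumOn-∈? : (A p : Subset n) → sumOn A (λ z → 𝟙 ⌊ z ∈? p ⌋) ≤ ∣ p ∣
  sumOn-∈? A p = begin
    sumOn A ind                           ≡⟨ sumOn-split A p ind ⟩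
    sumOn (A ─ p) ind + sumOn (A ∩ p) ind ≤⟨ +-mono-≤ (≤-reflexive (sumOn-0 (A ─ p) ind≡0)) (sumOn-≤ (A ∩ p) 1 (λ z _ → 𝟙-mono ⌊ z ∈? p ⌋ true _)) ⟩
    ∣ A ∩ p ∣ * 1                         ≡⟨ *-identityʳ _ ⟩
    ∣ A ∩ p ∣                             ≤⟨ ∣p∩q∣≤∣q∣ A p ⟩
    ∣ p ∣                                 ∎
    where
    ind = λ z → 𝟙 ⌊ z ∈? p ⌋
    ind≡0 : ∀ z → z ∈ A ─ p → ind z ≡ 0
    ind≡0 z z∈ with z ∈? p
    ... | yes z∈p = ⊥-elim (∈─⁻ A p z∈ z∈p)
    ... | no  _   = refl

  remove-one : (e : Subset n) (k : ℕ) → ∣ e ∣ ≡ suc k → ∃[ x ] ∃[ e′ ] (e ≡ ⁅ x ⁆ ∪ e′ × ∣ e′ ∣ ≡ k)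
  remove-one (inside  ∷ e) k size = zero , outside ∷ e , cong (inside ∷_) (sym (∪-identityˡ e)) , suc-injective size
  remove-one (outside ∷ e) k size with x , e′ , eq , size′ ← remove-one e k size =
    suc x , outside ∷ e′ , cong (outside ∷_) eq , size′

  ∣∣≡0⇒≡⊥ : (e : Subset n) → ∣ e ∣ ≡ 0 → e ≡ ⊥
  ∣∣≡0⇒≡⊥ []            _    = refl
  ∣∣≡0⇒≡⊥ (outside ∷ e) size = cong (outside ∷_) (∣∣≡0⇒≡⊥ e size)

  triple : Fin n → Fin n → Fin n → Subset n
  triple x y z = ⁅ x ⁆ ∪ (⁅ y ⁆ ∪ ⁅ z ⁆)

  triple-sym₂₃ : (x y z : Fin n) → triple x y z ≡ triple x z y
  triple-sym₂₃ x y z = cong (⁅ x ⁆ ∪_) (∪-comm ⁅ y ⁆ ⁅ z ⁆)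

  triple-sym₁₂ : (x y z : Fin n) → triple x y z ≡ triple y x z
  triple-sym₁₂ x y z = trans (sym (∪-assoc ⁅ x ⁆ ⁅ y ⁆ ⁅ z ⁆))
    (trans (cong (_∪ ⁅ z ⁆) (∪-comm ⁅ x ⁆ ⁅ y ⁆)) (∪-assoc ⁅ y ⁆ ⁅ x ⁆ ⁅ z ⁆))

  x∈triple : (x y z : Fin n) → x ∈ triple x y z
  x∈triple x y z = x∈p∪q⁺ (inj₁ (x∈⁅x⁆ x))

  y∈triple : (x y z : Fin n) → y ∈ triple x y z
  y∈triple x y z = subst (y ∈_) (triple-sym₁₂ y x z) (x∈triple y x z)

  z∈triple : (x y z : Fin n) → z ∈ triple x y z
  z∈triple x y z = subst (z ∈_) (triple-sym₂₃ x z y) (y∈triple x z y)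

  triple⊆ : (I : Subset n) {x y z : Fin n} → x ∈ I → y ∈ I → z ∈ I → triple x y z ⊆ I
  triple⊆ I {x} {y} {z} x∈I y∈I z∈I w∈ with x∈p∪q⁻ ⁅ x ⁆ _ w∈
  ... | inj₁ w∈x = subst (_∈ I) (sym (x∈⁅y⁆⇒x≡y x w∈x)) x∈I
  ... | inj₂ w∈yz with x∈p∪q⁻ ⁅ y ⁆ ⁅ z ⁆ w∈yz
  ... | inj₁ w∈y = subst (_∈ I) (sym (x∈⁅y⁆⇒x≡y y w∈y)) y∈I
  ... | inj₂ w∈z = subst (_∈ I) (sym (x∈⁅y⁆⇒x≡y z w∈z)) z∈I

  ∣triple-xx∣ : (x z : Fin n) → ∣ triple x x z ∣ ≤ 2
  ∣triple-xx∣ x z = begin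
    ∣ ⁅ x ⁆ ∪ (⁅ x ⁆ ∪ ⁅ z ⁆) ∣  ≡⟨ cong ∣_∣ (trans (sym (∪-assoc ⁅ x ⁆ ⁅ x ⁆ ⁅ z ⁆)) (cong (_∪ ⁅ z ⁆) (∪-idem ⁅ x ⁆))) ⟩
    ∣ ⁅ x ⁆ ∪ ⁅ z ⁆ ∣            ≤⟨ ∣∪∣≤ ⁅ x ⁆ ⁅ z ⁆ ⟩
    ∣ ⁅ x ⁆ ∣ + ∣ ⁅ z ⁆ ∣        ≡⟨ cong₂ _+_ (∣⁅x⁆∣≡1 x) (∣⁅x⁆∣≡1 z) ⟩
    2                            ∎

  3-set≡triple : (e : Subset n) → ∣ e ∣ ≡ 3 → ∃[ x ] ∃[ y ] ∃[ z ] e ≡ triple x y z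
  3-set≡triple e size
    with x , e₁ , refl , size₁ ← remove-one e 2 size
    with y , e₂ , refl , size₂ ← remove-one e₁ 1 size₁
    with z , e₃ , refl , size₃ ← remove-one e₂ 0 size₂
    with refl ← ∣∣≡0⇒≡⊥ e₃ size₃ = x , y , z , cong (λ r → ⁅ x ⁆ ∪ (⁅ y ⁆ ∪ r)) (∪-identityʳ ⁅ z ⁆)

  module Adjacency {n : ℕ} (H : Hypergraph3 n) where

    -- As a function of the union of singletons it is symmetric by construction, and it vanishes on
    -- repeated vertices, since such a union has at most two elements. Sums may therefore run over
    -- all ordered triples.
    adj : Fin n → Fin n → Fin n → ℕ
    adj x y z = 𝟙 (edge H (triple x y z))

    adj-sym₁₂ : ∀ x y z → adj x y z ≡ adj y x z
    adj-sym₁₂ x y z = cong (𝟙 ∘ edge H) (triple-sym₁₂ x y z)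

    adj-sym₂₃ : ∀ x y z → adj x y z ≡ adj x z y
    adj-sym₂₃ x y z = cong (𝟙 ∘ edge H) (triple-sym₂₃ x y z)

    edge-distinct : ∀ {x y z} → T (edge H (triple x y z)) → x ≢ y
    edge-distinct {x} {_} {z} t refl = 1+n≰n (≤-trans (≤-reflexive (sym (uniform H _ t))) (∣triple-xx∣ x z))

    adj-xx : ∀ x z → adj x x z ≡ 0
    adj-xx x z = n≤0⇒n≡0 (𝟙-mono (edge H (triple x x z)) false (λ t → edge-distinct t refl))

    -- An edge through x and y has exactly one further vertex.
    adj≤codeg : ∀ x y A → x ≢ y → sumOn A (adj x y) ≤ codeg H x y
    adj≤codeg x y A x≢y = begin
      sumOn A (adj x y)                                           ≤⟨ sumOn-mono A (λ z _ → ≤-trans (pointwise z) (sumSub-member (term z) (triple x y z))) ⟩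
      sumOn A (λ z → sumSub (term z))                             ≡⟨ sumSub-sumOn-swap A (λ e z → term z e) ⟨
      sumSub (λ e → sumOn A (λ z → term z e))                     ≤⟨ sumSub-mono perEdge ⟩
      sumSub (𝟙 ∘ r)                                              ≡⟨ countSub≡sumSub r ⟨
      codeg H x y                                                 ∎
      where
      r : Subset n → Bool
      r e = edge H e ∧ (⌊ x ∈? e ⌋ ∧ ⌊ y ∈? e ⌋)
      r⁺ : ∀ e → T (edge H e) → x ∈ e → y ∈ e → T (r e)
      r⁺ e t x∈e y∈e = Equivalence.from (T-∧ {edge H e}) (t ,
        Equivalence.from (T-∧ {⌊ x ∈? e ⌋}) (fromWitness {a? = x ∈? e} x∈e , fromWitness {a? = y ∈? e} y∈e))
      r⁻ : ∀ e → T (r e) → ∣ e ∣ ≡ 3 × x ∈ e × y ∈ e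
      r⁻ e t with te , txy ← Equivalence.to (T-∧ {edge H e}) t
             with tx , ty ← Equivalence.to (T-∧ {⌊ x ∈? e ⌋}) txy =
        uniform H e te , toWitness {a? = x ∈? e} tx , toWitness {a? = y ∈? e} ty
      rest : Subset n → Subset n
      rest e = e ─ ⁅ x ⁆ ─ ⁅ y ⁆
      term : Fin n → Subset n → ℕ
      term z e = 𝟙 (r e) * 𝟙 ⌊ z ∈? rest e ⌋
      pointwise : ∀ z → adj x y z ≤ term z (triple x y z)
      pointwise z with edge H (triple x y z) in eq
      ... | false = z≤n
      ... | true = ≤-reflexive (sym (cong₂ _*_ rest₁ rest₂))
        where
        e = triple x y z
        te : T (edge H e)
        te = Equivalence.from T-≡ eq
        z∉ : z ≢ x × z ≢ y
        z∉ = (λ { refl → edge-distinct (subst (T ∘ edge H) (triple-sym₂₃ x y z) te) refl })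
           , (λ { refl → edge-distinct (subst (T ∘ edge H) (trans (triple-sym₁₂ x y z) (triple-sym₂₃ y x z)) te) refl })
        rest₁ : 𝟙 (true ∧ (⌊ x ∈? e ⌋ ∧ ⌊ y ∈? e ⌋)) ≡ 1
        rest₁ = 𝟙-T _ (subst (λ b → T (b ∧ (⌊ x ∈? e ⌋ ∧ ⌊ y ∈? e ⌋))) eq (r⁺ e te (x∈triple x y z) (y∈triple x y z)))
        rest₂ : 𝟙 ⌊ z ∈? rest e ⌋ ≡ 1
        rest₂ = 𝟙-T _ (fromWitness {a? = z ∈? rest e} (x∈p∧x≢y⇒x∈p-y (x∈p∧x≢y⇒x∈p-y (z∈triple x y z) (proj₁ z∉)) (proj₂ z∉)))
      ∣rest∣ : ∀ e → T (r e) → ∣ rest e ∣ ≤ 1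
      ∣rest∣ e t with size , x∈e , y∈e ← r⁻ e t = s≤s⁻¹ (s≤s⁻¹ (begin
        suc (suc ∣ rest e ∣)   ≤⟨ s≤s (x∈p⇒∣p-x∣<∣p∣ (x∈p∧x≢y⇒x∈p-y y∈e (x≢y ∘ sym))) ⟩
        suc ∣ e ─ ⁅ x ⁆ ∣      ≤⟨ x∈p⇒∣p-x∣<∣p∣ x∈e ⟩
        ∣ e ∣                  ≡⟨ size ⟩
        3                      ∎))
      sumOn-*ˡ : ∀ A c (f : Fin n → ℕ) → c ≤ 1 → (1 ≤ c → sumOn A f ≤ 1) → sumOn A (λ z → c * f z) ≤ c
      sumOn-*ˡ A zero          f _ _ = ≤-reflexive (sumOn-0 A (λ _ _ → refl))
      sumOn-*ˡ A (suc zero)    f _ b = ≤-trans (≤-reflexive (sumOn-cong A (λ z → +-identityʳ (f z)))) (b ≤-refl)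
      sumOn-*ˡ A (suc (suc c)) f (s≤s ()) _
      perEdge : ∀ e → sumOn A (λ z → term z e) ≤ 𝟙 (r e)
      perEdge e = sumOn-*ˡ A (𝟙 (r e)) _ (𝟙-mono (r e) true _)
        (λ 1≤ → ≤-trans (sumOn-∈? A (rest e)) (∣rest∣ e (𝟙⁻ (r e) 1≤)))
        where
        𝟙⁻ : ∀ b → 1 ≤ 𝟙 b → T b
        𝟙⁻ true _ = _

    adj-codeg : ∀ K → (∀ u v → u ≢ v → codeg H u v ≤ K) → ∀ x y A → sumOn A (adj x y) ≤ K
    adj-codeg K bound x y A with x Fin.≟ y
    ... | yes refl = ≤-trans (≤-reflexive (sumOn-0 A (λ z _ → adj-xx x z))) z≤n
    ... | no x≢y   = ≤-trans (adj≤codeg x y A x≢y) (bound x y x≢y)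

    -- Each edge inside A is `triple x y z` for some x, y, z in A, and a given triple names only one
    -- set. One of the six orderings of an edge is enough here.
    eInduced≤ : ∀ A → eInduced H A ≤ sumOn A (λ x → sumOn A (λ y → sumOn A (adj x y)))
    eInduced≤ A = begin
      eInduced H A                                                                      ≡⟨ countSub≡sumSub r ⟩
      sumSub (𝟙 ∘ r)                                                                    ≤⟨ sumSub-mono perEdge ⟩
      sumSub (λ e → sumOn A (λ x → sumOn A (λ y → sumOn A (λ z → term x y z e))))       ≡⟨ sumSub-sumOn-swap A (λ e x → sumOn A (λ y → sumOn A (λ z → term x y z e))) ⟩
      sumOn A (λ x → sumSub (λ e → sumOn A (λ y → sumOn A (λ z → term x y z e))))
        ≡⟨ sumOn-cong A (λ x → trans (sumSub-sumOn-swap A (λ e y → sumOn A (λ z → term x y z e)))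
                                   (sumOn-cong A (λ y → sumSub-sumOn-swap A (λ e z → term x y z e)))) ⟩
      sumOn A (λ x → sumOn A (λ y → sumOn A (λ z → sumSub (term x y z))))
        ≤⟨ sumOn-mono A (λ x _ → sumOn-mono A (λ y _ → sumOn-mono A (λ z _ → perTriple (triple x y z)))) ⟩
      sumOn A (λ x → sumOn A (λ y → sumOn A (adj x y)))                                 ∎
      where
      _≟ˢ_ = Vec.≡-dec Bool._≟_
      r : Subset n → Bool
      r e = edge H e ∧ ⌊ e ⊆? A ⌋
      is : Subset n → Subset n → Bool
      is t e = edge H e ∧ ⌊ e ≟ˢ t ⌋
      is⁻ : ∀ t e → T (is t e) → T (edge H e) × e ≡ t
      is⁻ t e te with l , r ← Equivalence.to (T-∧ {edge H e}) te = l , toWitness {a? = e ≟ˢ t} r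
      term : Fin n → Fin n → Fin n → Subset n → ℕ
      term x y z e = 𝟙 (is (triple x y z) e)
      perTriple : ∀ t → sumSub (𝟙 ∘ is t) ≤ 𝟙 (edge H t)
      perTriple t with edge H t in eq
      ... | true  = sumSub-unique (is t) t (λ e te → proj₂ (is⁻ t e te))
      ... | false = ≤-reflexive (trans (sym (countSub≡sumSub (is t))) (countSub-none (is t) none))
        where
        none : ∀ e → ¬ T (is t e)
        none e te with l , refl ← is⁻ t e te = subst T eq l
      perEdge : ∀ e → 𝟙 (r e) ≤ sumOn A (λ x → sumOn A (λ y → sumOn A (λ z → term x y z e)))
      perEdge e with r e in eq
      ... | false = z≤n
      ... | true with te , e⊆ ← Equivalence.to (T-∧ {edge H e}) (Equivalence.from T-≡ eq)
                 with x , y , z , refl ← 3-set≡triple e (uniform H e te) = begin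
        1                                                              ≡⟨ 𝟙-T (is e e) (Equivalence.from (T-∧ {edge H e}) (te , fromWitness {a? = e ≟ˢ e} refl)) ⟨
        term x y z e                                                   ≤⟨ sumOn-member A (λ z → term x y z e) (e⊆A (z∈triple x y z)) ⟩
        sumOn A (λ z → term x y z e)                                   ≤⟨ sumOn-member A (λ y → sumOn A (λ z → term x y z e)) (e⊆A (y∈triple x y z)) ⟩
        sumOn A (λ y → sumOn A (λ z → term x y z e))                   ≤⟨ sumOn-member A _ (e⊆A (x∈triple x y z)) ⟩
        sumOn A (λ x → sumOn A (λ y → sumOn A (λ z → term x y z e)))   ∎
        where
        e⊆A : triple x y z ⊆ A
        e⊆A = toWitness {a? = triple x y z ⊆? A} e⊆

    independent⁻ : ∀ I → T (independentᵇ H I) → ∀ e → T (edge H e) → ¬ (e ⊆ I)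
    independent⁻ I t e te e⊆I = contra (edge H e ∧ ⌊ e ⊆? I ⌋)
      (allᵇ⁻ (λ e → not (edge H e ∧ ⌊ e ⊆? I ⌋)) (allSubsets n) t (∈-allSubsets e))
      (Equivalence.from (T-∧ {edge H e}) (te , fromWitness {a? = e ⊆? I} e⊆I))
      where
      contra : ∀ b → T (not b) → ¬ T b
      contra true ()

    independent⇒adj≡0 : ∀ I → T (independentᵇ H I) → ∀ {x y z} → x ∈ I → y ∈ I → z ∈ I → adj x y z ≡ 0
    independent⇒adj≡0 I t {x} {y} {z} x∈I y∈I z∈I =
      n≤0⇒n≡0 (𝟙-mono (edge H (triple x y z)) false (λ te → independent⁻ I t _ te (triple⊆ I x∈I y∈I z∈I)))

    independent⇒eInduced≡0 : ∀ I → T (independentᵇ H I) → eInduced H I ≡ 0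
    independent⇒eInduced≡0 I t = countSub-none (λ e → edge H e ∧ ⌊ e ⊆? I ⌋) none
      where
      none : ∀ e → ¬ T (edge H e ∧ ⌊ e ⊆? I ⌋)
      none e t′ with te , e⊆ ← Equivalence.to (T-∧ {edge H e}) t′ = independent⁻ I t e te (toWitness {a? = e ⊆? I} e⊆)

  -- Counting

  k≤2^k : ∀ k → k ≤ 2 ^ k
  k≤2^k zero    = z≤n
  k≤2^k (suc k) = +-mono-≤ (m^n>0 2 k) (≤-trans (k≤2^k k) (≤-reflexive (sym (+-identityʳ (2 ^ k)))))

  4k≤16^k : ∀ k → 4 * k ≤ 16 ^ k
  4k≤16^k zero    = z≤n
  4k≤16^k (suc k) = begin
    4 * suc k                ≡⟨ *-suc 4 k ⟩
    4 + 4 * k                ≤⟨ +-mono-≤ (*-monoˡ-≤ 4 (m^n>0 16 k)) (4k≤16^k k) ⟩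
    16 ^ k * 4 + 16 ^ k      ≤⟨ m≤m+n _ (11 * 16 ^ k) ⟩
    16 ^ k * 4 + 16 ^ k + 11 * 16 ^ k ≡⟨ eq (16 ^ k) ⟩
    16 * 16 ^ k              ∎
    where
    eq : ∀ x → x * 4 + x + 11 * x ≡ 16 * x
    eq = solve-∀

  halve-≤ : ∀ {x y} → 2 * x ≤ 2 * y → x ≤ y
  halve-≤ = *-cancelˡ-≤ 2

  -- Both l p and l q are at most m/2. For p, rounding and the budget give p ≤ 8g(d + K), and a
  -- further 4l to reach the bound makes up 32 l g; for q, the quadratic hypothesis on m is what is
  -- needed.
  fingerprint-small : ∀ l g K n m p q .{{_ : NonZero l}} .{{_ : NonZero g}} .{{_ : NonZero (2 * g)}} .{{_ : NonZero (32 * (l * g))}} →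
    p * (n / (2 * g)) ≤ 2 * (m / (32 * (l * g)) + K) * n → q * (m / (32 * (l * g))) ≤ K * n →
    2 * g ≤ n → 32 * (l * g) * suc K ≤ m → 4 * (l * (32 * (l * g) * K)) * n ≤ m * m →
    l * (p + q) ≤ m
  fingerprint-small l g K n m p q p≤ q≤ 2g≤n ΛK≤m quad = halve-≤ (begin
    2 * (l * (p + q))         ≡⟨ eq l p q ⟩
    2 * (l * p) + 2 * (l * q) ≤⟨ +-mono-≤ p-part q-part ⟩
    m + m                     ≡⟨ cong (m +_) (+-identityʳ m) ⟨
    2 * m                     ∎)
    where
    Λ = 32 * (l * g)
    d = m / Λ
    c = n / (2 * g)
    eq : ∀ l p q → 2 * (l * (p + q)) ≡ 2 * (l * p) + 2 * (l * q)
    eq = solve-∀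
    Λ≤m : Λ ≤ m
    Λ≤m = ≤-trans (m≤m*n Λ (suc K)) ΛK≤m
    instance
      n≢0 : NonZero n
      n≢0 = >-nonZero (≤-trans (>-nonZero⁻¹ (2 * g)) 2g≤n)
      m≢0 : NonZero m
      m≢0 = >-nonZero (≤-trans (>-nonZero⁻¹ Λ) Λ≤m)
    -- Rounding down a quotient that is at least 1 loses at most a factor 2.
    ceil : ∀ x y .{{_ : NonZero y}} → y ≤ x → x ≤ 2 * (x / y) * y
    ceil x y y≤x = begin
      x                    ≤⟨ ≤-trans (≤-reflexive (m≡m%n+[m/n]*n x y)) (+-monoˡ-≤ (x / y * y) (<⇒≤ (m%n<n x y))) ⟩
      suc (x / y) * y      ≤⟨ *-monoˡ-≤ y (+-monoˡ-≤ (x / y) (m≥n⇒m/n>0 y≤x)) ⟩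
      (x / y + x / y) * y  ≡⟨ cong (λ j → (x / y + j) * y) (+-identityʳ (x / y)) ⟨
      2 * (x / y) * y      ∎
    p≤8gD : p ≤ 8 * (g * (d + K))
    p≤8gD = *-cancelʳ-≤ p (8 * (g * (d + K))) n (begin
      p * n                         ≤⟨ *-monoʳ-≤ p (ceil n (2 * g) 2g≤n) ⟩
      p * (2 * c * (2 * g))         ≡⟨ e₁ p c g ⟩
      4 * g * (p * c)               ≤⟨ *-monoʳ-≤ (4 * g) p≤ ⟩
      4 * g * (2 * (d + K) * n)     ≡⟨ e₂ g (d + K) n ⟩
      8 * (g * (d + K)) * n         ∎)
      where
      e₁ : ∀ p c g → p * (2 * c * (2 * g)) ≡ 4 * g * (p * c)
      e₁ = solve-∀
      e₂ : ∀ g D n → 4 * g * (2 * D * n) ≡ 8 * (g * D) * n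
      e₂ = solve-∀
    p-part : 2 * (l * p) ≤ m
    p-part = halve-≤ (begin
      2 * (2 * (l * p))                        ≤⟨ *-monoʳ-≤ 2 (*-monoʳ-≤ 2 (*-monoʳ-≤ l p≤8gD)) ⟩
      2 * (2 * (l * (8 * (g * (d + K)))))      ≡⟨ e₁ l g d K ⟩
      d * Λ + Λ * K                            ≤⟨ +-mono-≤ (m/n*n≤m m Λ) (≤-trans (*-monoʳ-≤ Λ (n≤1+n K)) ΛK≤m) ⟩
      m + m                                    ≡⟨ cong (m +_) (+-identityʳ m) ⟨
      2 * m                                    ∎)
      where
      e₁ : ∀ l g d K → 2 * (2 * (l * (8 * (g * (d + K))))) ≡ d * (32 * (l * g)) + 32 * (l * g) * K
      e₁ = solve-∀
    q-part : 2 * (l * q) ≤ m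
    q-part = *-cancelʳ-≤ (2 * (l * q)) m m (begin
      2 * (l * q) * m                     ≤⟨ *-monoʳ-≤ (2 * (l * q)) (ceil m Λ Λ≤m) ⟩
      2 * (l * q) * (2 * d * Λ)           ≡⟨ e₁ l q d Λ ⟩
      4 * (l * Λ) * (q * d)               ≤⟨ *-monoʳ-≤ (4 * (l * Λ)) q≤ ⟩
      4 * (l * Λ) * (K * n)               ≡⟨ e₂ l Λ K n ⟩
      4 * (l * (Λ * K)) * n               ≤⟨ quad ⟩
      m * m                               ∎)
      where
      e₁ : ∀ l q d Λ → 2 * (l * q) * (2 * d * Λ) ≡ 4 * (l * Λ) * (q * d)
      e₁ = solve-∀
      e₂ : ∀ l Λ K n → 4 * (l * Λ) * (K * n) ≡ 4 * (l * (Λ * K)) * n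
      e₂ = solve-∀

  -- In the L-th power (f/g)^m becomes at most 2^(-4m), Y^R at most 2^m, and (1 + m/u)^n at most 4^m
  -- because nL = u. Altogether the factor 2^(-m) remains.
  take-root : ∀ f n m R Y X b .{{_ : NonZero f}} .{{_ : NonZero n}} →
    let g = suc f ; L = 4 * g ; u = L * n in
    Y * L * R ≤ m → g ^ m * (X * u ^ n) ≤ f ^ m * (Y ^ R * b) * (u + m) ^ n →
    X ^ L * 2 ^ m ≤ b ^ L
  take-root f n m R Y X b small bound = *-cancelˡ-≤ (F * U * (2 ^ m * 4 ^ m)) (begin
    F * U * (2 ^ m * 4 ^ m) * (X ^ L * 2 ^ m)      ≡⟨ e₁ F U (2 ^ m) (4 ^ m) (X ^ L) ⟩
    2 ^ m * 2 ^ m * 4 ^ m * F * (X ^ L * U)        ≡⟨ cong (λ j → j * F * (X ^ L * U)) 16^m ⟩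
    2 ^ (4 * m) * F * (X ^ L * U)                  ≤⟨ *-monoˡ-≤ (X ^ L * U) gap ⟩
    (g ^ m) ^ L * (X ^ L * U)                      ≡⟨ cong (λ j → (g ^ m) ^ L * (X ^ L * j)) U≡ ⟨
    (g ^ m) ^ L * (X ^ L * (u ^ n) ^ L)            ≡⟨ trans (^-distribʳ-* L (g ^ m) _) (cong ((g ^ m) ^ L *_) (^-distribʳ-* L X (u ^ n))) ⟨
    (g ^ m * (X * u ^ n)) ^ L                      ≤⟨ ^-monoˡ-≤ L bound ⟩
    (f ^ m * (Y ^ R * b) * (u + m) ^ n) ^ L        ≡⟨ trans (^-distribʳ-* L (f ^ m * (Y ^ R * b)) _)
                                                         (cong₂ _*_ (trans (^-distribʳ-* L (f ^ m) _) (cong₂ _*_ F≡ (^-distribʳ-* L (Y ^ R) b)))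
                                                           (trans (^-*-assoc (u + m) n L) (cong ((u + m) ^_) (*-comm n L)))) ⟩
    F * ((Y ^ R) ^ L * b ^ L) * (u + m) ^ u        ≤⟨ *-mono-≤ (*-monoʳ-≤ F (*-monoˡ-≤ (b ^ L) Y-small)) ([y+m]^y≤y^y*4^m u m) ⟩
    F * (2 ^ m * b ^ L) * (U * 4 ^ m)              ≡⟨ e₂ F (2 ^ m) (b ^ L) U (4 ^ m) ⟩
    F * U * (2 ^ m * 4 ^ m) * b ^ L                ∎)
    where
    g = suc f
    L = 4 * g
    u = L * n
    F = f ^ (g * (4 * m))
    U = u ^ u
    instance
      u≢0 : NonZero u
      u≢0 = m*n≢0 L n
      F≢0 : NonZero F
      F≢0 = m^n≢0 f (g * (4 * m))
      U≢0 : NonZero U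
      U≢0 = m^n≢0 u u
      FU≢0 : NonZero (F * U)
      FU≢0 = m*n≢0 F U
      2^≢0 : NonZero (2 ^ m)
      2^≢0 = m^n≢0 2 m
      4^≢0 : NonZero (4 ^ m)
      4^≢0 = m^n≢0 4 m
      2^·4^≢0 : NonZero (2 ^ m * 4 ^ m)
      2^·4^≢0 = m*n≢0 (2 ^ m) (4 ^ m)
      all≢0 : NonZero (F * U * (2 ^ m * 4 ^ m))
      all≢0 = m*n≢0 (F * U) (2 ^ m * 4 ^ m)
    exponent : ∀ m g → m * (4 * g) ≡ g * (4 * m)
    exponent = solve-∀
    F≡ : (f ^ m) ^ L ≡ F
    F≡ = trans (^-*-assoc f m L) (cong (f ^_) (exponent m g))
    U≡ : (u ^ n) ^ L ≡ U
    U≡ = trans (^-*-assoc u n L) (cong (u ^_) (*-comm n L))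
    16^m : 2 ^ m * 2 ^ m * 4 ^ m ≡ 2 ^ (4 * m)
    16^m = trans (cong (2 ^ m * 2 ^ m *_) (^-*-assoc 2 2 m))
          (trans (cong (_* 2 ^ (2 * m)) (sym (^-distribˡ-+-* 2 m m)))
          (trans (sym (^-distribˡ-+-* 2 (m + m) (2 * m))) (cong (2 ^_) (e m))))
      where
      e : ∀ m → m + m + 2 * m ≡ 4 * m
      e = solve-∀
    gap : 2 ^ (4 * m) * F ≤ (g ^ m) ^ L
    gap = begin
      2 ^ (4 * m) * F                       ≡⟨ cong (2 ^ (4 * m) *_) (^-*-assoc f g (4 * m)) ⟨
      2 ^ (4 * m) * (f ^ g) ^ (4 * m)       ≡⟨ ^-distribʳ-* (4 * m) 2 (f ^ g) ⟨
      (2 * f ^ g) ^ (4 * m)                 ≤⟨ ^-monoˡ-≤ (4 * m) (2*f^g≤g^g f) ⟩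
      (g ^ g) ^ (4 * m)                     ≡⟨ ^-*-assoc g g (4 * m) ⟩
      g ^ (g * (4 * m))                     ≡⟨ cong (g ^_) (exponent m g) ⟨
      g ^ (m * L)                           ≡⟨ ^-*-assoc g m L ⟨
      (g ^ m) ^ L                           ∎
    Y-small : (Y ^ R) ^ L ≤ 2 ^ m
    Y-small = begin
      (Y ^ R) ^ L           ≡⟨ ^-*-assoc Y R L ⟩
      Y ^ (R * L)           ≤⟨ ^-monoˡ-≤ (R * L) (k≤2^k Y) ⟩
      (2 ^ Y) ^ (R * L)     ≡⟨ ^-*-assoc 2 Y (R * L) ⟩
      2 ^ (Y * (R * L))     ≤⟨ ^-monoʳ-≤ 2 (≤-trans (≤-reflexive (e Y R L)) small) ⟩
      2 ^ m                 ∎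
      where
      e : ∀ Y R L → Y * (R * L) ≡ Y * L * R
      e = solve-∀
    e₁ : ∀ F U a b x → F * U * (a * b) * (x * a) ≡ a * a * b * F * (x * U)
    e₁ = solve-∀
    e₂ : ∀ F a b U c → F * (a * b) * (U * c) ≡ F * U * (a * c) * b
    e₂ = solve-∀

  -- Fingerprints have at most m / fingerprintRatio elements, and a vertex is queried for its
  -- link degree as soon as that reaches m / degreeRatio.
  fingerprintRatio degreeRatio : ℕ → ℕ → ℕ
  fingerprintRatio d f = suc (2 * (16 ^ d * suc f) * (4 * suc f) * (4 * suc f) + 4 * d)
  degreeRatio d f = 32 * (fingerprintRatio d f * suc f)

  -- Natural-number form of the hypotheses: α ≥ 1/a, δ ≥ 1/d, γ = 1/h and β, βc ≥ 1/g
  -- (c the constant in e(Hₙ) ≥ cn²), with g = f + 1.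
  module Counting {n m : ℕ} (H : Hypergraph3 n) (B : Family n) (K a d f : ℕ) (q : Subset n → Bool)
    {{n≢0 : NonZero n}} {{m≢0 : NonZero m}} {{a≢0 : NonZero a}} {{f≢0 : NonZero f}}
    (codeg≤K : ∀ u v → u ≢ v → codeg H u v ≤ K)
    (q-size : ∀ I → T (q I) → ∣ I ∣ ≡ m)
    (q-indep : ∀ I → T (q I) → T (independentᵇ H I))
    (q-far : ∀ I → T (q I) → ∀ X → T (B X) → m ≤ d * ∣ I ─ X ∣)
    (2a≤g : 2 * a ≤ suc f) (n≤aN : n ≤ a * norm B)
    where

    open Adjacency H

    -- An element outside X has weight `z`; at least m/d such elements give I a weight of at least
    -- 16^m. `h` is 1/γ. A fingerprint element will cost `Z * m / n`, where `Z` covers both the 2g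
    -- of `fibre-small` and the zg of `fibre-structured`.
    g z h N Z : ℕ
    g = suc f
    z = 16 ^ d
    h = z * (2 * a)
    N = norm B
    Z = 2 * (z * g)

    b : ℕ
    b = N C m

    instance
      z≢0 : NonZero z
      z≢0 = m^n≢0 16 d

    g≤2f : g ≤ 2 * f
    g≤2f = +-mono-≤ (>-nonZero⁻¹ f) (≤-reflexive (sym (+-identityʳ f)))

    -- Stability with cleared denominators. The first alternative, |A| ≤ N - n/g, compares A with N
    -- because the final count is measured against C(N, m).
    Dichotomy : Set
    Dichotomy = ∀ A → g * eInduced H A < n * n →
      (g * ∣ A ∣ + n ≤ g * N) ⊎ (∃[ X ] (T (B X) × h * ∣ A ─ X ∣ ≤ n))

    -- From n ≤ aN ≤ 2am and the choice of h follows z |A ─ X| ≤ m. So I has at most |S| + m/z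
    -- elements outside X, which is at most m/(2d) and falls short of the required m/d.
    no-large-member : ∀ S A X I → T (B X) → 4 * (d * ∣ S ∣) ≤ m → N ≤ 2 * m → h * ∣ A ─ X ∣ ≤ n →
                      T (q I) → ¬ (I ⊆ S ∪ A)
    no-large-member S A X I BX 4ds≤m N≤2m hy≤n qI I⊆ = 1+n≰n (≤-trans (>-nonZero⁻¹ m) (+-cancelˡ-≤ (m + m) m 0 (begin
      m + m + m                              ≤⟨ m≤m+n _ m ⟩
      m + m + m + m                          ≡⟨ e₁ m ⟩
      4 * m                                  ≤⟨ *-monoʳ-≤ 4 (≤-trans (q-far I qI X BX) (*-monoʳ-≤ d (≤-trans (p⊆q⇒∣p∣≤∣q∣ I─X⊆) (∣∪∣≤ S (A ─ X))))) ⟩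
      4 * (d * (∣ S ∣ + y))                  ≡⟨ e₂ d (∣ S ∣) y ⟩
      4 * (d * ∣ S ∣) + 4 * d * y            ≤⟨ +-mono-≤ 4ds≤m (≤-trans (*-monoˡ-≤ y (4k≤16^k d)) zy≤m) ⟩
      m + m                                  ≡⟨ +-identityʳ (m + m) ⟨
      m + m + 0                              ∎)))
      where
      y = ∣ A ─ X ∣
      I─X⊆ : I ─ X ⊆ S ∪ (A ─ X)
      I─X⊆ {x} x∈ with x∈p∪q⁻ S A (I⊆ (p─q⊆p I X x∈))
      ... | inj₁ x∈S = x∈p∪q⁺ (inj₁ x∈S)
      ... | inj₂ x∈A = x∈p∪q⁺ (inj₂ (x∈p∧x∉q⇒x∈p─q x∈A (∈─⁻ I X x∈)))
      instance
        2a≢0 : NonZero (2 * a)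
        2a≢0 = m*n≢0 2 a
      zy≤m : z * y ≤ m
      zy≤m = *-cancelˡ-≤ (2 * a) (begin
        2 * a * (z * y)     ≡⟨ e₃ a z y ⟩
        h * y               ≤⟨ hy≤n ⟩
        n                   ≤⟨ n≤aN ⟩
        a * N               ≤⟨ *-monoʳ-≤ a N≤2m ⟩
        a * (2 * m)         ≡⟨ e₄ a m ⟩
        2 * a * m           ∎)
        where
        e₃ : ∀ a z y → 2 * a * (z * y) ≡ z * (2 * a) * y
        e₃ = solve-∀
        e₄ : ∀ a m → a * (2 * m) ≡ 2 * a * m
        e₄ = solve-∀
      e₁ : ∀ m → m + m + m + m ≡ 4 * m
      e₁ = solve-∀
      e₂ : ∀ d s y → 4 * (d * (s + y)) ≡ 4 * (d * s) + 4 * d * y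
      e₂ = solve-∀

    fibre : Subset n → Subset n → ℕ
    fibre S A = countSub (λ I → q I ∧ between S A I)

    -- Markov's inequality for the weight t^|I ─ X|.
    weighted-fibre : ∀ S A X t w k .{{_ : NonZero t}} → Disjoint S A → ∣ S ∣ + k ≡ m → (∀ I → T (q I) → w ≤ t ^ ∣ I ─ X ∣) →
                     fibre S A * w ≤ t ^ ∣ S ∣ * extC t A X k
    weighted-fibre S A X t w k dis s+k≡m w≤ = begin
      fibre S A * w                                ≡⟨ cong (_* w) (countSub≡sumSub p) ⟩
      sumSub (𝟙 ∘ p) * w                           ≡⟨ *-comm _ w ⟩
      w * sumSub (𝟙 ∘ p)                           ≡⟨ sumSub-*ˡ w (𝟙 ∘ p) ⟨
      sumSub (λ I → w * 𝟙 (p I))                   ≤⟨ sumSub-mono (λ I → term I (p I) (proj₁ ∘ p⁻ I)) ⟩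
      sumSub (λ I → 𝟙 (p I) * t ^ ∣ I ─ X ∣)       ≤⟨ weighted-extensions t S A X k p dis (λ I pI → let qI , S⊆I , I⊆ = p⁻ I pI in S⊆I , I⊆ , trans (q-size I qI) (sym s+k≡m)) ⟩
      t ^ ∣ S ∣ * extC t A X k                     ∎
      where
      p : Subset n → Bool
      p I = q I ∧ between S A I
      p⁻ : ∀ I → T (p I) → T (q I) × (S ⊆ I) × (I ⊆ S ∪ A)
      p⁻ I pI with qI , btw ← Equivalence.to (T-∧ {q I}) pI = qI , between⁻ S A I btw
      term : ∀ I bit → (T bit → T (q I)) → w * 𝟙 bit ≤ 𝟙 bit * t ^ ∣ I ─ X ∣
      term I true  qI = ≤-trans (≤-reflexive (*-identityʳ w)) (≤-trans (w≤ I (qI _)) (m≤m+n _ 0))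
      term I false _  = ≤-reflexive (*-zeroʳ w)

    -- Only the k elements outside the fingerprint profit from `C-shrink`. Each element of S misses
    -- one factor f/g and pays gm/n for the climb to C(N, m); as g ≤ 2f, the two together cost at
    -- most 2gm/n ≤ Zm/n.
    fibre-small : ∀ S A k → Disjoint S A → ∣ S ∣ + k ≡ m → g * m + n ≤ g * N → g * ∣ A ∣ + n ≤ g * N →
                  g ^ m * (fibre S A * n ^ ∣ S ∣) ≤ f ^ m * ((Z * m) ^ ∣ S ∣ * b)
    fibre-small S A k dis s+k≡m gm+n≤gN gx+n≤gN = begin
      g ^ m * (fibre S A * n ^ s)                  ≡⟨ cong (λ j → g ^ j * (fibre S A * n ^ s)) s+k≡m ⟨
      g ^ (s + k) * (fibre S A * n ^ s)            ≡⟨ cong (_* (fibre S A * n ^ s)) (^-distribˡ-+-* g s k) ⟩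
      g ^ s * g ^ k * (fibre S A * n ^ s)          ≤⟨ *-monoʳ-≤ (g ^ s * g ^ k) (*-monoˡ-≤ (n ^ s) fibre≤) ⟩
      g ^ s * g ^ k * ((x C k) * n ^ s)            ≡⟨ e₁ (g ^ s) (g ^ k) (x C k) (n ^ s) ⟩
      g ^ s * (g ^ k * (x C k)) * n ^ s            ≤⟨ *-monoˡ-≤ (n ^ s) (*-monoʳ-≤ (g ^ s) (C-shrink f x N k gx≤fN)) ⟩
      g ^ s * (f ^ k * (N C k)) * n ^ s            ≡⟨ e₂ (g ^ s) (f ^ k) (N C k) (n ^ s) ⟩
      g ^ s * f ^ k * (n ^ s * (N C k))            ≤⟨ *-monoʳ-≤ (g ^ s * f ^ k) (C-climb n g N m s k gm+n≤gN (≤-reflexive s+k≡m)) ⟩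
      g ^ s * f ^ k * ((g * m) ^ s * (N C (s + k)))  ≡⟨ cong (λ j → g ^ s * f ^ k * ((g * m) ^ s * (N C j))) s+k≡m ⟩
      g ^ s * f ^ k * ((g * m) ^ s * b)            ≡⟨ e₃ (g ^ s) (f ^ k) ((g * m) ^ s) b ⟩
      g ^ s * (g * m) ^ s * (f ^ k * b)            ≤⟨ *-monoˡ-≤ (f ^ k * b) absorb ⟩
      f ^ s * (Z * m) ^ s * (f ^ k * b)            ≡⟨ e₄ (f ^ s) ((Z * m) ^ s) (f ^ k) b ⟩
      f ^ s * f ^ k * ((Z * m) ^ s * b)            ≡⟨ cong (_* ((Z * m) ^ s * b)) (^-distribˡ-+-* f s k) ⟨
      f ^ (s + k) * ((Z * m) ^ s * b)              ≡⟨ cong (λ j → f ^ j * ((Z * m) ^ s * b)) s+k≡m ⟩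
      f ^ m * ((Z * m) ^ s * b)                    ∎
      where
      s = ∣ S ∣
      x = ∣ A ∣
      -- Weight 1 and X = ⊤ specialise the weighted count to a plain one.
      fibre≤ : fibre S A ≤ x C k
      fibre≤ = begin
        fibre S A                                  ≡⟨ *-identityʳ _ ⟨
        fibre S A * 1                              ≤⟨ weighted-fibre S A ⊤ 1 1 k dis s+k≡m (λ I _ → ≤-reflexive (sym (^-zeroˡ (∣ I ─ ⊤ ∣)))) ⟩
        1 ^ s * extC 1 A ⊤ k                       ≡⟨ cong₂ (λ i j → i * mixedC 1 j (∣ A ∩ ⊤ ∣) k) (^-zeroˡ s) (trans (cong ∣_∣ (p─⊤≡⊥ A)) (∣⊥∣≡0 n)) ⟩
        1 * (∣ A ∩ ⊤ ∣ C k)                        ≡⟨ trans (*-identityˡ _) (cong (λ p → ∣ p ∣ C k) (∩-identityʳ A)) ⟩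
        x C k                                      ∎
      -- N ≤ n turns the additive gap n/g into the multiplicative one x ≤ (f/g) N.
      gx≤fN : g * x ≤ f * N
      gx≤fN = +-cancelˡ-≤ N _ _ (begin
        N + g * x      ≡⟨ +-comm N _ ⟩
        g * x + N      ≤⟨ +-monoʳ-≤ (g * x) (norm≤n B) ⟩
        g * x + n      ≤⟨ gx+n≤gN ⟩
        g * N          ∎)
      absorb : g ^ s * (g * m) ^ s ≤ f ^ s * (Z * m) ^ s
      absorb = begin
        g ^ s * (g * m) ^ s          ≡⟨ ^-distribʳ-* s g (g * m) ⟨
        (g * (g * m)) ^ s            ≤⟨ ^-monoˡ-≤ s (begin
          g * (g * m)                ≤⟨ *-mono-≤ g≤2f (*-monoˡ-≤ m (m≤n*m g z)) ⟩
          2 * f * (z * g * m)        ≡⟨ e₅ f (z * g) m ⟩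
          f * (Z * m)                ∎) ⟩
        (f * (Z * m)) ^ s            ≡⟨ ^-distribʳ-* s f (Z * m) ⟩
        f ^ s * (Z * m) ^ s          ∎
        where
        e₅ : ∀ f w m → 2 * f * (w * m) ≡ f * (2 * w * m)
        e₅ = solve-∀
      e₁ : ∀ p q c w → p * q * (c * w) ≡ p * (q * c) * w
      e₁ = solve-∀
      e₂ : ∀ p q c w → p * (q * c) * w ≡ p * q * (w * c)
      e₂ = solve-∀
      e₃ : ∀ p q r b → p * q * (r * b) ≡ p * r * (q * b)
      e₃ = solve-∀
      e₄ : ∀ p q r b → p * q * (r * b) ≡ p * r * (q * b)
      e₄ = solve-∀

    -- For N > 2m every I weighs at least 16^m, and all of them together at most z^s 4^m C(N, k).
    -- This leaves a gain of 4^m, while each fingerprint element costs z for its weight and gm/n for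
    -- the climb.
    fibre-structured : ∀ S A X k → T (B X) → Disjoint S A → ∣ S ∣ + k ≡ m → 4 * (d * ∣ S ∣) ≤ m →
                       g * m + n ≤ g * N → h * ∣ A ─ X ∣ ≤ n →
                       g ^ m * (fibre S A * n ^ ∣ S ∣) ≤ f ^ m * ((Z * m) ^ ∣ S ∣ * b)
    fibre-structured S A X k BX dis s+k≡m 4ds≤m gm+n≤gN hy≤n with N ≤? 2 * m
    ... | yes N≤2m = ≤-trans (≤-reflexive (trans (cong (λ j → g ^ m * (j * n ^ ∣ S ∣)) empty) (*-zeroʳ (g ^ m)))) z≤n
      where
      empty : fibre S A ≡ 0
      empty = countSub-none _ none
        where
        none : ∀ I → ¬ T (q I ∧ between S A I)
        none I t with qI , btw ← Equivalence.to (T-∧ {q I}) t =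
          no-large-member S A X I BX 4ds≤m N≤2m hy≤n qI (proj₂ (between⁻ S A I btw))
    ... | no N≰2m = begin
      -- The gain 4^(-m) is weakened to (f/g)^m, to agree with `fibre-small`.
      g ^ m * (c * n ^ s)                     ≤⟨ *-monoˡ-≤ (c * n ^ s) (≤-trans (^-monoˡ-≤ m g≤4f) (≤-reflexive (^-distribʳ-* m 4 f))) ⟩
      4 ^ m * f ^ m * (c * n ^ s)             ≡⟨ e₁ (4 ^ m) (f ^ m) c (n ^ s) ⟩
      f ^ m * (c * 4 ^ m * n ^ s)             ≤⟨ *-monoʳ-≤ (f ^ m) main ⟩
      f ^ m * (z ^ s * ((g * m) ^ s * b))     ≡⟨ cong (f ^ m *_) (trans (sym (*-assoc (z ^ s) _ b)) (cong (_* b) (sym (^-distribʳ-* s z (g * m))))) ⟩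
      f ^ m * ((z * (g * m)) ^ s * b)         ≤⟨ *-monoʳ-≤ (f ^ m) (*-monoˡ-≤ b (^-monoˡ-≤ s (≤-trans (m≤m+n _ (z * (g * m))) (≤-reflexive (e₂ z g m))))) ⟩
      f ^ m * ((Z * m) ^ s * b)               ∎
      where
      s = ∣ S ∣
      c = fibre S A
      y = ∣ A ─ X ∣
      x = ∣ A ∩ X ∣
      instance
        n^y≢0 : NonZero (n ^ y)
        n^y≢0 = m^n≢0 n y
        4^m≢0 : NonZero (4 ^ m)
        4^m≢0 = m^n≢0 4 m
      g≤4f : g ≤ 4 * f
      g≤4f = ≤-trans g≤2f (*-monoˡ-≤ f {2} {4} (s≤s (s≤s z≤n)))
      weight : ∀ I → T (q I) → 16 ^ m ≤ z ^ ∣ I ─ X ∣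
      weight I qI = ≤-trans (^-monoʳ-≤ 16 (q-far I qI X BX)) (≤-reflexive (sym (^-*-assoc 16 d (∣ I ─ X ∣))))
      -- N > 2m gives N - m ≥ N/2 ≥ n/(2a). The constant must be 2a and not g, since it enters h,
      -- which is fixed before g.
      below-half : 2 * a * m + n ≤ 2 * a * N
      below-half = begin
        2 * a * m + n        ≤⟨ +-mono-≤ (≤-trans (≤-reflexive (e a m)) (*-monoʳ-≤ a (<⇒≤ (≰⇒> N≰2m)))) n≤aN ⟩
        a * N + a * N        ≡⟨ e′ a N ⟩
        2 * a * N            ∎
        where
        e : ∀ a m → 2 * a * m ≡ a * (2 * m)
        e = solve-∀
        e′ : ∀ a N → a * N + a * N ≡ 2 * a * N
        e′ = solve-∀
      mixed≤ : extC z A X k ≤ 4 ^ m * (N C k)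
      mixed≤ = *-cancelˡ-≤ (n ^ y) (begin
        n ^ y * mixedC z y x k                ≤⟨ mixedC-bound n (2 * a) N m z y x k below-half (≤-trans (∣p∩q∣≤∣q∣ A X) (∣∣≤norm B X BX)) (≤-trans (m≤n+m k s) (≤-reflexive s+k≡m)) ⟩
        (n + z * (2 * a * m)) ^ y * (N C k)   ≡⟨ cong (λ j → (n + j) ^ y * (N C k)) (*-assoc z (2 * a) m) ⟨
        (n + h * m) ^ y * (N C k)             ≤⟨ *-monoˡ-≤ (N C k) ([n+h*m]^y≤n^y*4^m n h m y hy≤n) ⟩
        n ^ y * 4 ^ m * (N C k)               ≡⟨ *-assoc (n ^ y) (4 ^ m) _ ⟩
        n ^ y * (4 ^ m * (N C k))             ∎)
      main : c * 4 ^ m * n ^ s ≤ z ^ s * ((g * m) ^ s * b)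
      main = *-cancelˡ-≤ (4 ^ m) (begin
        4 ^ m * (c * 4 ^ m * n ^ s)                ≡⟨ e (4 ^ m) c (n ^ s) ⟩
        c * (4 ^ m * 4 ^ m) * n ^ s                ≡⟨ cong (λ j → c * j * n ^ s) (^-distribʳ-* m 4 4) ⟨
        c * 16 ^ m * n ^ s                         ≤⟨ *-monoˡ-≤ (n ^ s) (weighted-fibre S A X z (16 ^ m) k dis s+k≡m weight) ⟩
        z ^ s * extC z A X k * n ^ s               ≤⟨ *-monoˡ-≤ (n ^ s) (*-monoʳ-≤ (z ^ s) mixed≤) ⟩
        z ^ s * (4 ^ m * (N C k)) * n ^ s          ≡⟨ e′ (z ^ s) (4 ^ m) (N C k) (n ^ s) ⟩
        4 ^ m * (z ^ s * (n ^ s * (N C k)))        ≤⟨ *-monoʳ-≤ (4 ^ m) (*-monoʳ-≤ (z ^ s) (C-climb n g N m s k gm+n≤gN (≤-reflexive s+k≡m))) ⟩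
        4 ^ m * (z ^ s * ((g * m) ^ s * (N C (s + k)))) ≡⟨ cong (λ j → 4 ^ m * (z ^ s * ((g * m) ^ s * (N C j)))) s+k≡m ⟩
        4 ^ m * (z ^ s * ((g * m) ^ s * b))        ∎)
        where
        e : ∀ p c w → p * (c * p * w) ≡ c * (p * p) * w
        e = solve-∀
        e′ : ∀ z p c w → z * (p * c) * w ≡ p * (z * (w * c))
        e′ = solve-∀
      e₁ : ∀ p q c w → p * q * (c * w) ≡ q * (c * p * w)
      e₁ = solve-∀
      e₂ : ∀ z g m → z * (g * m) + z * (g * m) ≡ 2 * (z * g) * m
      e₂ = solve-∀

    -- The summand `Y * L` of `l` makes Y^(RL) at most 2^m in `take-root`. The summand `4 * d` gives
    -- 4d|S| ≤ m: the fingerprint is at most a quarter of the m/d elements that I must have outside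
    -- X.
    L Y l Λ : ℕ
    L = 4 * g
    Y = Z * L
    l = fingerprintRatio d f
    Λ = degreeRatio d f

    module _ (dichotomy : Dichotomy) (2g≤n : 2 * g ≤ n) (ΛK≤m : Λ * suc K ≤ m) (quad : 4 * (l * (Λ * K)) * n ≤ m * m) where

      instance
        Z≢0 : NonZero Z
        Z≢0 = m*n≢0 2 (z * g) {{_}} {{m*n≢0 z g}}
        Y≢0 : NonZero Y
        Y≢0 = m*n≢0 Z L
        lg≢0 : NonZero (l * g)
        lg≢0 = m*n≢0 l g
        Λ≢0 : NonZero Λ
        Λ≢0 = m*n≢0 32 (l * g)

      R c u M : ℕ
      R = m / l
      c = n / (2 * g)
      u = L * n
      M = f ^ m * (Y ^ R * b)

      open Container {n} K (m / Λ) c adj adj-sym₁₂ adj-sym₂₃ (adj-codeg K codeg≤K)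

      lR≤m : l * R ≤ m
      lR≤m = ≤-trans (≤-reflexive (*-comm l R)) (m/n*n≤m m l)

      -- The degree threshold n/(2g), half of n/g, makes the inequality strict, so that it
      -- contradicts the non-strict dense alternative of stability.
      leaf-sparse : ∀ S A → Leaf S A → g * eInduced H A < n * n
      leaf-sparse S A (_ , deg≤ , _) = *-cancelˡ-< 2 _ _ (begin-strict
        2 * (g * eInduced H A)     ≤⟨ *-monoʳ-≤ 2 (*-monoʳ-≤ g (≤-trans (eInduced≤ A) deg≤)) ⟩
        2 * (g * (n * c))          ≡⟨ e g n c ⟩
        n * (c * (2 * g))          ≤⟨ *-monoʳ-≤ n (m/n*n≤m n (2 * g)) ⟩
        n * n                      <⟨ m<m*n (n * n) 2 {{m*n≢0 n n}} (s≤s (s≤s z≤n)) ⟩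
        n * n * 2                  ≡⟨ *-comm (n * n) 2 ⟩
        2 * (n * n)                ∎)
        where
        e : ∀ g n c → 2 * (g * (n * c)) ≡ n * (c * (2 * g))
        e = solve-∀

      leaf-size : ∀ S A → Leaf S A → l * ∣ S ∣ ≤ m
      leaf-size S A (_ , _ , p , q , size , p≤ , q≤) =
        ≤-trans (≤-reflexive (cong (l *_) size)) (fingerprint-small l g K n m p q p≤ q≤ 2g≤n ΛK≤m quad)

      leaf-fibre : g * m + n ≤ g * N → ∀ S A → Leaf S A → g ^ m * (fibre S A * n ^ ∣ S ∣) ≤ f ^ m * ((Z * m) ^ ∣ S ∣ * b)
      leaf-fibre gm+n≤gN S A lf@(dis , _)
        with dichotomy A (leaf-sparse S A lf)
      ... | inj₁ small = fibre-small S A (m ∸ ∣ S ∣) dis (m+[n∸m]≡n (≤-trans (m≤n*m (∣ S ∣) l) (leaf-size S A lf))) gm+n≤gN small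
      ... | inj₂ (X , BX , hy≤n) =
        fibre-structured S A X (m ∸ ∣ S ∣) BX dis (m+[n∸m]≡n (≤-trans (m≤n*m (∣ S ∣) l) (leaf-size S A lf)))
          (≤-trans (≤-trans (≤-reflexive (sym (*-assoc 4 d (∣ S ∣)))) (*-monoˡ-≤ (∣ S ∣) (≤-trans (m≤n+m (4 * d) (Y * L)) (n≤1+n _)))) (leaf-size S A lf))
          gm+n≤gN hy≤n

      -- Replacing n^s by u^s costs L^s, which turns Z into Y = ZL. Then Y^s ≤ Y^R makes the bound
      -- uniform over the leaves, as `countBetween-bound` requires.
      leaf-bound : g * m + n ≤ g * N → ∀ S A → Leaf S A → g ^ m * (fibre S A * u ^ ∣ S ∣) ≤ M * m ^ ∣ S ∣
      leaf-bound gm+n≤gN S A lf = begin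
        g ^ m * (fibre S A * u ^ s)                  ≡⟨ cong (λ j → g ^ m * (fibre S A * j)) (^-distribʳ-* s L n) ⟩
        g ^ m * (fibre S A * (L ^ s * n ^ s))        ≡⟨ e₁ (g ^ m) (fibre S A) (L ^ s) (n ^ s) ⟩
        L ^ s * (g ^ m * (fibre S A * n ^ s))        ≤⟨ *-monoʳ-≤ (L ^ s) (leaf-fibre gm+n≤gN S A lf) ⟩
        L ^ s * (f ^ m * ((Z * m) ^ s * b))          ≡⟨ cong (λ j → L ^ s * (f ^ m * (j * b))) (^-distribʳ-* s Z m) ⟩
        L ^ s * (f ^ m * (Z ^ s * m ^ s * b))        ≡⟨ e₂ (L ^ s) (f ^ m) (Z ^ s) (m ^ s) b ⟩
        f ^ m * (Z ^ s * L ^ s * b) * m ^ s          ≡⟨ cong (λ j → f ^ m * (j * b) * m ^ s) (^-distribʳ-* s Z L) ⟨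
        f ^ m * (Y ^ s * b) * m ^ s                  ≤⟨ *-monoˡ-≤ (m ^ s) (*-monoʳ-≤ (f ^ m) (*-monoˡ-≤ b (^-monoʳ-≤ Y s≤R))) ⟩
        M * m ^ s                                    ∎
        where
        s = ∣ S ∣
        s≤R : s ≤ R
        s≤R = ≤-trans (≤-reflexive (sym (m*n/n≡m s l))) (/-monoˡ-≤ l (≤-trans (≤-reflexive (*-comm s l)) (leaf-size S A lf)))
        e₁ : ∀ G c x y → G * (c * (x * y)) ≡ x * (G * (c * y))
        e₁ = solve-∀
        e₂ : ∀ x F z y b → x * (F * (z * y * b)) ≡ F * (z * x * b) * y
        e₂ = solve-∀

      -- An independent I spans no edge, so the dichotomy applies to A = I. Its first alternative is
      -- the negated hypothesis with |I| = m; its second is excluded by `no-large-member` with an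
      -- empty fingerprint.
      large-empty : ¬ (g * m + n ≤ g * N) → countSub q ≡ 0
      large-empty large = countSub-none q none
        where
        -- Here N - m < n/g ≤ aN/g ≤ N/2, by 2a ≤ g.
        N≤2m : N ≤ 2 * m
        N≤2m = *-cancelˡ-≤ g (+-cancelʳ-≤ (g * N) _ _ (begin
          g * N + g * N              ≡⟨ cong (g * N +_) (+-identityʳ (g * N)) ⟨
          2 * (g * N)                ≤⟨ *-monoʳ-≤ 2 (≤-trans (<⇒≤ (≰⇒> large)) (+-monoʳ-≤ (g * m) n≤aN)) ⟩
          2 * (g * m + a * N)        ≡⟨ e g m a N ⟩
          g * (2 * m) + 2 * a * N    ≤⟨ +-monoʳ-≤ (g * (2 * m)) (*-monoˡ-≤ N 2a≤g) ⟩
          g * (2 * m) + g * N        ∎))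
          where
          e : ∀ g m a N → 2 * (g * m + a * N) ≡ g * (2 * m) + 2 * a * N
          e = solve-∀
        none : ∀ I → ¬ T (q I)
        none I qI with dichotomy I (≤-trans (≤-reflexive (cong suc (trans (cong (g *_) (independent⇒eInduced≡0 I (q-indep I qI))) (*-zeroʳ g)))) (>-nonZero⁻¹ (n * n) {{m*n≢0 n n}}))
        ... | inj₁ small = large (subst (λ j → g * j + n ≤ g * N) (q-size I qI) small)
        ... | inj₂ (X , BX , hy≤n) = no-large-member ⊥ I X I BX
          (≤-trans (≤-reflexive (trans (cong (λ j → 4 * (d * j)) (∣⊥∣≡0 n)) (cong (4 *_) (*-zeroʳ d)))) z≤n)
          N≤2m hy≤n qI (q⊆p∪q ⊥ I)

      count-bound : countSub q ^ L * 2 ^ m ≤ b ^ L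
      count-bound with g * m + n ≤? g * N
      ... | no large = ≤-trans (≤-reflexive (cong (λ j → j ^ L * 2 ^ m) (large-empty large))) z≤n
      ... | yes gm+n≤gN = take-root f n m R Y (countSub q) b
        (≤-trans (*-monoˡ-≤ R (≤-trans (m≤m+n (Y * L) (4 * d)) (n≤1+n _))) lR≤m)
        (begin
          g ^ m * (countSub q * u ^ n)               ≤⟨ *-monoʳ-≤ (g ^ m) (*-monoˡ-≤ (u ^ n) (countSub≤countBetween Indep Leaf q q⇒Indep)) ⟩
          g ^ m * (fibre ⊥ ⊤ * u ^ n)                ≡⟨ cong (λ j → g ^ m * (fibre ⊥ ⊤ * u ^ (j + n))) (∣⊥∣≡0 n) ⟨
          g ^ m * (fibre ⊥ ⊤ * u ^ (∣ ⊥ {n} ∣ + n))  ≤⟨ countBetween-bound Indep Leaf q q⇒Indep (g ^ m) M u m (leaf-bound gm+n≤gN) queryTree n (∣p∣≤n ⊤) ⟩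
          M * m ^ ∣ ⊥ {n} ∣ * (u + m) ^ n            ≡⟨ cong (λ j → M * m ^ j * (u + m) ^ n) (∣⊥∣≡0 n) ⟩
          M * 1 * (u + m) ^ n                        ≡⟨ cong (_* (u + m) ^ n) (*-identityʳ M) ⟩
          M * (u + m) ^ n                            ∎)
        where
        q⇒Indep : ∀ I → T (q I) → Indep I
        q⇒Indep I qI = independent⇒adj≡0 I (q-indep I qI)

open Finite

open import Data.Bool using (Bool; T; true; _∧_; _∨_; not)
open import Data.Bool.Properties using (T-∧)
open import Data.Nat as ℕ using (ℕ; zero; suc; _*_; _^_; z≤n; s≤s; >-nonZero; >-nonZero⁻¹)
import Data.Nat.Properties as ℕ
open import Data.Nat.Tactic.RingSolver using (solve-∀)
open import Data.Fin.Subset using (Subset; ∣_∣; _─_)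
open import Data.Integer as ℤ using (+_)
import Data.Integer.Properties as ℤ
open import Data.Rational using (ℚ; mkℚ; _≤_; _<_; 0ℚ; 1ℚ; _-_; _+_; -_; 1/_; toℚᵘ; NonNegative; Positive; positive; nonNegative)
import Data.Rational as ℚ
import Data.Rational.Properties as ℚ
open import Data.Rational.Unnormalised as ℚᵘ using (mkℚᵘ; *≡*; *≤*) renaming (_≃_ to _≃ᵘ_)
import Data.Rational.Unnormalised.Properties as ℚᵘ
open import Data.Product using (_×_; _,_; proj₁; proj₂; ∃-syntax)
open import Data.Sum using (_⊎_; inj₁; inj₂)
open import Data.Empty using (⊥-elim)
open import Function using (Equivalence)
open import Relation.Nullary using (Dec; yes; no)
open import Relation.Nullary.Decidable using (⌊_⌋; toWitness)
open import Relation.Binary.PropositionalEquality using (_≡_; _≢_; refl; sym; trans; cong; cong₂; subst; subst₂)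

-- From ℕ to ℚ

toℚᵘ-⟦⟧ : ∀ k → toℚᵘ ⟦ k ⟧ ≃ᵘ mkℚᵘ (+ k) 0
toℚᵘ-⟦⟧ k = ℚ.toℚᵘ-fromℚᵘ (mkℚᵘ (+ k) 0)

⟦⟧-mono : ∀ {j k} → j ℕ.≤ k → ⟦ j ⟧ ≤ ⟦ k ⟧
⟦⟧-mono {j} {k} j≤k = ℚ.toℚᵘ-cancel-≤ (ℚᵘ.≤-respˡ-≃ (ℚᵘ.≃-sym (toℚᵘ-⟦⟧ j)) (ℚᵘ.≤-respʳ-≃ (ℚᵘ.≃-sym (toℚᵘ-⟦⟧ k))
  (*≤* (subst₂ ℤ._≤_ (sym (ℤ.*-identityʳ (+ j))) (sym (ℤ.*-identityʳ (+ k))) (ℤ.+≤+ j≤k)))))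

⟦⟧-cancel : ∀ {j k} → ⟦ j ⟧ ≤ ⟦ k ⟧ → j ℕ.≤ k
⟦⟧-cancel {j} {k} j≤k with ℚᵘ.≤-respˡ-≃ (toℚᵘ-⟦⟧ j) (ℚᵘ.≤-respʳ-≃ (toℚᵘ-⟦⟧ k) (ℚ.toℚᵘ-mono-≤ j≤k))
... | *≤* le = ℤ.drop‿+≤+ (subst₂ ℤ._≤_ (ℤ.*-identityʳ (+ j)) (ℤ.*-identityʳ (+ k)) le)

⟦⟧-* : ∀ j k → ⟦ j * k ⟧ ≡ ⟦ j ⟧ ℚ.* ⟦ k ⟧
⟦⟧-* j k = ℚ.toℚᵘ-injective (ℚᵘ.≃-trans (toℚᵘ-⟦⟧ (j * k)) (ℚᵘ.≃-sym (ℚᵘ.≃-trans (ℚ.toℚᵘ-homo-* ⟦ j ⟧ ⟦ k ⟧)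
  (ℚᵘ.≃-trans (ℚᵘ.*-cong (toℚᵘ-⟦⟧ j) (toℚᵘ-⟦⟧ k)) (*≡* (cong (ℤ._* + 1) (sym (ℤ.pos-* j k))))))))

⟦⟧-+ : ∀ j k → ⟦ j ℕ.+ k ⟧ ≡ ⟦ j ⟧ + ⟦ k ⟧
⟦⟧-+ j k = ℚ.toℚᵘ-injective (ℚᵘ.≃-trans (toℚᵘ-⟦⟧ (j ℕ.+ k)) (ℚᵘ.≃-sym (ℚᵘ.≃-trans (ℚ.toℚᵘ-homo-+ ⟦ j ⟧ ⟦ k ⟧)
  (ℚᵘ.≃-trans (ℚᵘ.+-cong (toℚᵘ-⟦⟧ j) (toℚᵘ-⟦⟧ k))
    (*≡* (cong (ℤ._* + 1) (cong₂ ℤ._+_ (ℤ.*-identityʳ (+ j)) (ℤ.*-identityʳ (+ k)))))))))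

0≤⟦⟧ : ∀ k → 0ℚ ≤ ⟦ k ⟧
0≤⟦⟧ k = ⟦⟧-mono {0} {k} z≤n

archimedean : ∀ p → 0ℚ < p → ∃[ t ] (ℕ.NonZero t × 1ℚ ≤ ⟦ t ⟧ ℚ.* p)
archimedean p 0<p with p | positive 0<p
... | mkℚ (+ zero)    t _ | record { pos = () }
... | mkℚ ℤ.-[1+ _ ]  t _ | record { pos = () }
-- The witness is the denominator of p, stored as its predecessor t; the numerator is at least 1.
... | p@(mkℚ (+ suc k) t _) | _ = suc t , _ , ℚ.toℚᵘ-cancel-≤ (ℚᵘ.≤-respʳ-≃
  (ℚᵘ.≃-sym (ℚᵘ.≃-trans (ℚ.toℚᵘ-homo-* ⟦ suc t ⟧ p) (ℚᵘ.*-congʳ (toℚᵘ-⟦⟧ (suc t)))))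
  (*≤* (ℤ.+≤+ (ℕ.≤-trans (ℕ.≤-reflexive (e₁ t)) (ℕ.≤-trans (ℕ.m≤m+n (suc t) (suc t * k)) (ℕ.≤-reflexive (e₂ t k)))))))
  where
  e₁ : ∀ t → 1 * (1 * suc t) ≡ suc t
  e₁ = solve-∀
  e₂ : ∀ t k → suc t ℕ.+ suc t * k ≡ suc t * suc k * 1
  e₂ = solve-∀

module _ {n : ℕ} (H : Hypergraph3 n) (B : Family n) (m : ℕ) (far : Subset n → Subset n → Bool) where

  member⁻ : ∀ I → T (⌊ ∣ I ∣ ℕ.≟ m ⌋ ∧ (independentᵇ H I ∧ allᵇ (λ X → not (B X) ∨ far I X) (allSubsets n))) →
            ∣ I ∣ ≡ m × T (independentᵇ H I) × (∀ X → T (B X) → T (far I X))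
  member⁻ I t with size , rest ← Equivalence.to (T-∧ {⌊ ∣ I ∣ ℕ.≟ m ⌋}) t
              with ind , all ← Equivalence.to (T-∧ {independentᵇ H I}) rest =
    toWitness {a? = ∣ I ∣ ℕ.≟ m} size , ind ,
    λ X BX → not-∨ (B X) (far I X) BX (allᵇ⁻ (λ X → not (B X) ∨ far I X) (allSubsets n) all (∈-allSubsets X))
    where
    not-∨ : ∀ x y → T x → T (not x ∨ y) → T y
    not-∨ true y _ t = t

-- toWitness with its type spelled out, so that no decision procedure on ℚ gets unfolded.
T⌊⌋⁻ : {P : Set} (P? : Dec P) → T ⌊ P? ⌋ → P
T⌊⌋⁻ P? = toWitness {a? = P?}

inSF⁻ : ∀ {n} (H : Hypergraph3 n) (B : Family n) (δ : ℚ) (m : ℕ) (I : Subset n) → T (inSFᵇ H B δ m I) →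
        ∣ I ∣ ≡ m × T (independentᵇ H I) × (∀ X → T (B X) → δ ℚ.* ⟦ m ⟧ ≤ ⟦ ∣ I ─ X ∣ ⟧)
inSF⁻ H B δ m I t = proj₁ mem , proj₁ (proj₂ mem) , λ X BX → T⌊⌋⁻ (δ ℚ.* ⟦ m ⟧ ℚ.≤? ⟦ ∣ I ─ X ∣ ⟧) (proj₂ (proj₂ mem) X BX)
  where
  mem = member⁻ H B m (λ I X → ⌊ δ ℚ.* ⟦ m ⟧ ℚ.≤? ⟦ ∣ I ─ X ∣ ⟧ ⌋) I t

1≤⇒positive : ∀ {p} → 1ℚ ≤ p → Positive p
1≤⇒positive 1≤p = positive (ℚ.<-≤-trans (ℚ.positive⁻¹ 1ℚ) 1≤p)

^ℚ-nonNeg : ∀ p → 0ℚ ≤ p → ∀ k → 0ℚ ≤ p ^ℚ k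
^ℚ-nonNeg p 0≤p zero    = ℚ.nonNegative⁻¹ 1ℚ
^ℚ-nonNeg p 0≤p (suc k) = ℚ.nonNegative⁻¹ (p ℚ.* p ^ℚ k)
  {{ℚ.nonNeg*nonNeg⇒nonNeg p {{nonNegative 0≤p}} (p ^ℚ k) {{nonNegative (^ℚ-nonNeg p 0≤p k)}}}}

*-nonNeg : ∀ {p r} → 0ℚ ≤ p → 0ℚ ≤ r → 0ℚ ≤ p ℚ.* r
*-nonNeg {p} {r} 0≤p 0≤r = ℚ.nonNegative⁻¹ (p ℚ.* r)
  {{ℚ.nonNeg*nonNeg⇒nonNeg p {{nonNegative 0≤p}} r {{nonNegative 0≤r}}}}

^ℚ-mono : ∀ {p r} → 0ℚ ≤ p → p ≤ r → ∀ k → p ^ℚ k ≤ r ^ℚ k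
^ℚ-mono 0≤p p≤r zero    = ℚ.≤-refl
^ℚ-mono {p} {r} 0≤p p≤r (suc k) = ℚ.≤-trans
  (ℚ.*-monoʳ-≤-nonNeg (p ^ℚ k) {{nonNegative (^ℚ-nonNeg p 0≤p k)}} p≤r)
  (ℚ.*-monoˡ-≤-nonNeg r {{nonNegative (ℚ.≤-trans 0≤p p≤r)}} (^ℚ-mono 0≤p p≤r k))

sub-≤ : ∀ p r → 0ℚ ≤ r → p - r ≤ p
sub-≤ p r 0≤r = ℚ.≤-trans (ℚ.+-monoʳ-≤ p (ℚ.neg-antimono-≤ 0≤r)) (ℚ.≤-reflexive (ℚ.+-identityʳ p))

-- ⟦_⟧ is replaced by a variable ι, since unification would unfold it into a normalised fraction.
module Embedded (ι : ℕ → ℚ) (0≤ι : ∀ k → 0ℚ ≤ ι k) (ι-1 : ι 1 ≡ 1ℚ)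
  (ι-mono : ∀ {j k} → j ℕ.≤ k → ι j ≤ ι k) (ι-cancel : ∀ {j k} → ι j ≤ ι k → j ℕ.≤ k)
  (ι-+ : ∀ j k → ι (j ℕ.+ k) ≡ ι j + ι k) (ι-* : ∀ j k → ι (j * k) ≡ ι j ℚ.* ι k)
  (ι-archimedean : ∀ p → 0ℚ < p → ∃[ t ] (ℕ.NonZero t × 1ℚ ≤ ι t ℚ.* p)) where

  ι-^ : ∀ j k → ι (j ^ k) ≡ ι j ^ℚ k
  ι-^ j zero    = ι-1
  ι-^ j (suc k) = trans (ι-* j (j ^ k)) (cong (ι j ℚ.*_) (ι-^ j k))

  instance
    ι-nonNegative : ∀ {k} → NonNegative (ι k)
    ι-nonNegative {k} = nonNegative (0≤ι k)

  reciprocal : ∀ h .{{_ : ℕ.NonZero h}} → ∃[ γ ] (0ℚ < γ × ι h ℚ.* γ ≡ 1ℚ)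
  reciprocal h = 1/ (ι h) , ℚ.positive⁻¹ (1/ (ι h)) {{ℚ.1/pos⇒pos (ι h)}} , ℚ.*-inverseʳ (ι h)
    where
    instance
      ιh-positive : Positive (ι h)
      ιh-positive = 1≤⇒positive (subst (_≤ (ι h)) ι-1 (ι-mono (>-nonZero⁻¹ h)))
      ιh≢0 : ℚ.NonZero (ι h)
      ιh≢0 = ℚ.pos⇒nonZero (ι h)

  -- Replaces p by the smaller 1/t; α, δ and βc reach the natural-number counting this way.
  clear-denominator : ∀ {t p j k} → 1ℚ ≤ ι t ℚ.* p → p ℚ.* ι k ≤ ι j → k ℕ.≤ t * j
  clear-denominator {t} {p} {j} {k} 1≤tp pk≤j = ι-cancel (begin
    ι k                      ≡⟨ ℚ.*-identityˡ (ι k) ⟨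
    1ℚ ℚ.* ι k               ≤⟨ ℚ.*-monoʳ-≤-nonNeg (ι k) {{ι-nonNegative {k}}} 1≤tp ⟩
    ι t ℚ.* p ℚ.* ι k      ≡⟨ ℚ.*-assoc (ι t) p (ι k) ⟩
    ι t ℚ.* (p ℚ.* ι k)    ≤⟨ ℚ.*-monoˡ-≤-nonNeg (ι t) {{ι-nonNegative {t}}} pk≤j ⟩
    ι t ℚ.* ι j            ≡⟨ ι-* t j ⟨
    ι (t * j)                  ∎)
    where open ℚ.≤-Reasoning

  -- If A is below (α - β)n, then N ≥ αn leaves |A| ≤ N - βn, where 1/t₁ ≤ β. The second reciprocal,
  -- 1/t₂ ≤ βc, turns density relative to e(H) ≥ cn² into density relative to n².
  stable⇒dichotomy : ∀ {n α β γ c} (H : Hypergraph3 n) (B : Family n) (h t₁ t₂ g : ℕ) .{{_ : ℕ.NonZero t₁}} →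
    ι h ℚ.* γ ≡ 1ℚ →
    1ℚ ≤ ι t₁ ℚ.* β → 1ℚ ≤ ι t₂ ℚ.* (β ℚ.* c) → t₁ ℕ.≤ g → t₂ ℕ.≤ g → 0ℚ ≤ β →
    α ℚ.* ι n ≤ ι (norm B) → c ℚ.* ι (n * n) ≤ ι (eH H) →
    (∀ A → (α - β) ℚ.* ι n ≤ ι (∣ A ∣) →
      (β ℚ.* ι (eH H) ≤ ι (eInduced H A)) ⊎ (∃[ X ] (T (B X) × ι (∣ A ─ X ∣) ≤ γ ℚ.* ι n))) →
    ∀ A → g * eInduced H A ℕ.< n * n →
    (g * ∣ A ∣ ℕ.+ n ℕ.≤ g * norm B) ⊎ (∃[ X ] (T (B X) × h * ∣ A ─ X ∣ ℕ.≤ n))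
  stable⇒dichotomy {n} {α} {β} {γ} {c} H B h t₁ t₂ g hγ≡1 1≤t₁β 1≤t₂βc t₁≤g t₂≤g 0≤β norm≥ edges≥ stable A sparse
    with (α - β) ℚ.* ι n ℚ.≤? ι (∣ A ∣)
  ... | yes large with stable A large
  ... | inj₁ dense = ⊥-elim (ℕ.<⇒≱ sparse (ℕ.≤-trans (clear-denominator {t₂} {β ℚ.* c} 1≤t₂βc (begin
      β ℚ.* c ℚ.* ι (n * n)       ≡⟨ ℚ.*-assoc β c (ι (n * n)) ⟩
      β ℚ.* (c ℚ.* ι (n * n))     ≤⟨ ℚ.*-monoˡ-≤-nonNeg β {{nonNegative 0≤β}} edges≥ ⟩
      β ℚ.* ι (eH H)              ≤⟨ dense ⟩
      ι (eInduced H A)            ∎)) (ℕ.*-monoˡ-≤ (eInduced H A) t₂≤g)))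
    where open ℚ.≤-Reasoning
  ... | inj₂ (X , BX , small) = inj₂ (X , BX , ι-cancel (begin
      ι (h * ∣ A ─ X ∣)                   ≡⟨ ι-* h (∣ A ─ X ∣) ⟩
      ι h ℚ.* ι (∣ A ─ X ∣)             ≤⟨ ℚ.*-monoˡ-≤-nonNeg (ι h) {{ι-nonNegative {h}}} small ⟩
      ι h ℚ.* (γ ℚ.* ι n)            ≡⟨ ℚ.*-assoc (ι h) γ (ι n) ⟨
      ι h ℚ.* γ ℚ.* ι n              ≡⟨ cong (ℚ._* (ι n)) hγ≡1 ⟩
      1ℚ ℚ.* ι n                        ≡⟨ ℚ.*-identityˡ (ι n) ⟩
      ι n                               ∎))
    where open ℚ.≤-Reasoning
  stable⇒dichotomy {n} {α} {β} {γ} {c} H B h t₁ t₂ g hγ≡1 1≤t₁β 1≤t₂βc t₁≤g t₂≤g 0≤β norm≥ edges≥ stable A sparse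
      | no small = inj₁ (enlarge t₁A+n≤t₁N (ℕ.*-cancelˡ-≤ t₁ (ℕ.≤-trans (ℕ.m≤m+n _ n) t₁A+n≤t₁N)))
    where
    t = t₁
    x = ∣ A ∣
    N = norm B
    cancel : (α - β) ℚ.* ι n + β ℚ.* ι n ≡ α ℚ.* ι n
    cancel = trans (sym (ℚ.*-distribʳ-+ (ι n) (α - β) β))
      (cong (ℚ._* (ι n)) (trans (ℚ.+-assoc α (- β) β) (trans (cong (λ j → α + j) (ℚ.+-inverseˡ β)) (ℚ.+-identityʳ α))))
    t₁A+n≤t₁N : t * x ℕ.+ n ℕ.≤ t * N
    t₁A+n≤t₁N = ι-cancel (begin
      ι (t * x ℕ.+ n)                                      ≡⟨ trans (ι-+ (t * x) n) (cong₂ _+_ (ι-* t x) (sym (ℚ.*-identityˡ (ι n)))) ⟩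
      ι t ℚ.* ι x + 1ℚ ℚ.* ι n                       ≤⟨ ℚ.+-monoʳ-≤ (ι t ℚ.* ι x) (ℚ.*-monoʳ-≤-nonNeg (ι n) {{ι-nonNegative {n}}} 1≤t₁β) ⟩
      ι t ℚ.* ι x + ι t ℚ.* β ℚ.* ι n              ≡⟨ trans (cong (λ j → ι t ℚ.* ι x + j) (ℚ.*-assoc (ι t) β (ι n))) (sym (ℚ.*-distribˡ-+ (ι t) (ι x) (β ℚ.* ι n))) ⟩
      ι t ℚ.* (ι x + β ℚ.* ι n)                      ≤⟨ ℚ.*-monoˡ-≤-nonNeg (ι t) {{ι-nonNegative {t}}} (ℚ.+-monoˡ-≤ (β ℚ.* ι n) (ℚ.<⇒≤ (ℚ.≰⇒> small))) ⟩
      ι t ℚ.* ((α - β) ℚ.* ι n + β ℚ.* ι n)          ≡⟨ cong (ι t ℚ.*_) cancel ⟩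
      ι t ℚ.* (α ℚ.* ι n)                              ≤⟨ ℚ.*-monoˡ-≤-nonNeg (ι t) {{ι-nonNegative {t}}} norm≥ ⟩
      ι t ℚ.* ι N                                      ≡⟨ ι-* t N ⟨
      ι (t * N)                                            ∎)
      where open ℚ.≤-Reasoning
    -- Passing from t₁ to g weakens the gap n/t₁ to n/g; x ≤ N is used for the remaining g - t₁
    -- copies.
    enlarge : t * x ℕ.+ n ℕ.≤ t * N → x ℕ.≤ N → g * x ℕ.+ n ℕ.≤ g * N
    enlarge hyp x≤N = subst (λ j → j * x ℕ.+ n ℕ.≤ j * N) (ℕ.m+[n∸m]≡n t₁≤g) (begin
      (t ℕ.+ r) * x ℕ.+ n          ≡⟨ e t r x n ⟩
      t * x ℕ.+ n ℕ.+ r * x        ≤⟨ ℕ.+-mono-≤ hyp (ℕ.*-monoʳ-≤ r x≤N) ⟩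
      t * N ℕ.+ r * N              ≡⟨ ℕ.*-distribʳ-+ N t r ⟨
      (t ℕ.+ r) * N                ∎)
      where
      open ℕ.≤-Reasoning
      r = g ℕ.∸ t
      e : ∀ t r x n → (t ℕ.+ r) * x ℕ.+ n ≡ t * x ℕ.+ n ℕ.+ r * x
      e = solve-∀

  module _ (H : (n : ℕ) → Hypergraph3 n) (B : (n : ℕ) → Family n) (δ : ℚ) (0<δ : 0ℚ < δ)
    (S : (n m : ℕ) → Subset n → Bool)
    (S-member : ∀ n m I → T (S n m I) →
      ∣ I ∣ ≡ m × T (independentᵇ (H n) I) × (∀ X → T (B n X) → δ ℚ.* ι m ≤ ι (∣ I ─ X ∣)))
    (a d f K N₁ : ℕ)
    {{a≢0 : ℕ.NonZero a}} {{f≢0 : ℕ.NonZero f}}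
    (codeg≤K : ∀ n u v → u ≢ v → codeg (H n) u v ℕ.≤ K)
    (1≤dδ : 1ℚ ≤ ι d ℚ.* δ) (2a≤g : 2 * a ℕ.≤ suc f) (n≤aN : ∀ n → n ℕ.≤ a * norm (B n))
    (dichotomy : ∀ n → N₁ ℕ.≤ n → ∀ A → suc f * eInduced (H n) A ℕ.< n * n →
      (suc f * ∣ A ∣ ℕ.+ n ℕ.≤ suc f * norm (B n)) ⊎ (∃[ X ] (T (B n X) × 16 ^ d * (2 * a) * ∣ A ─ X ∣ ℕ.≤ n)))
    where

    private
      Λ C₀ N₀ : ℕ
      Λ = degreeRatio d f
      -- `quad` asks for C₀² ≥ 4lΛK; the successor makes C₀ ≥ 1, hence C₀² ≥ C₀.
      C₀ = suc (4 * (fingerprintRatio d f * (Λ * K)))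
      -- The square is there so that m² ≥ C₀² n ≥ n yields m ≥ Λ(K + 1).
      N₀ = N₁ ℕ.+ (2 * suc f ℕ.+ Λ * suc K * (Λ * suc K))

    counting-theorem :
      ∃[ C ] (0ℚ < C ×
        ∃[ p ] ∃[ q ] ∃[ N ]
          ((n m : ℕ) → N ℕ.≤ n → (C ℚ.* C) ℚ.* ι n ≤ ι (m * m) →
            let D = ι (countSub (S n m)) - (δ ^ℚ m) ℚ.* ι (card (B n) * binom (norm (B n)) m)
                b = binom (norm (B n)) m
            in (D ≤ 0ℚ) ⊎ ((D ^ℚ suc q) ℚ.* ι (2 ^ (suc p * m)) ≤ ι (b ^ suc q))))
    counting-theorem = ι C₀ , ℚ.positive⁻¹ (ι C₀) {{1≤⇒positive (subst (_≤ (ι C₀)) ι-1 (ι-mono (s≤s z≤n)))}} ,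
      -- The successor of the second entry is 4 * suc f by computation, so ε = 1/(4g).
      0 , f ℕ.+ 3 * suc f , N₀ , bound
      where
      bound : ∀ n m → N₀ ℕ.≤ n → (ι C₀ ℚ.* ι C₀) ℚ.* ι n ≤ ι (m * m) →
        let D = ι (countSub (S n m)) - (δ ^ℚ m) ℚ.* ι (card (B n) * binom (norm (B n)) m)
            b = binom (norm (B n)) m
        in (D ≤ 0ℚ) ⊎ ((D ^ℚ suc (f ℕ.+ 3 * suc f)) ℚ.* ι (2 ^ (1 * m)) ≤ ι (b ^ suc (f ℕ.+ 3 * suc f)))
      bound n m N₀≤n Cn≤m² = conclude
        where
        SF = countSub (S n m)
        b = binom (norm (B n)) m
        L = 4 * suc f
        E = (δ ^ℚ m) ℚ.* ι (card (B n) * b)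
        D = ι SF - E
        C₀²n≤m² : C₀ * C₀ * n ℕ.≤ m * m
        C₀²n≤m² = ι-cancel (subst (_≤ (ι (m * m))) (sym (trans (ι-* (C₀ * C₀) n) (cong (ℚ._* (ι n)) (ι-* C₀ C₀)))) Cn≤m²)
        quad : 4 * (fingerprintRatio d f * (Λ * K)) * n ℕ.≤ m * m
        quad = ℕ.≤-trans (ℕ.*-monoˡ-≤ n (ℕ.≤-trans (ℕ.n≤1+n _) (ℕ.m≤m*n C₀ C₀))) C₀²n≤m²
        N₁≤n : N₁ ℕ.≤ n
        N₁≤n = ℕ.≤-trans (ℕ.m≤m+n N₁ _) N₀≤n
        2g≤n : 2 * suc f ℕ.≤ n
        2g≤n = ℕ.≤-trans (ℕ.≤-trans (ℕ.m≤m+n (2 * suc f) _) (ℕ.m≤n+m _ N₁)) N₀≤n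
        ΛK≤m : Λ * suc K ℕ.≤ m
        ΛK≤m = ℕ.≮⇒≥ λ m< → ℕ.<⇒≱ (ℕ.*-mono-< m< m<)
          (ℕ.≤-trans (ℕ.≤-trans (ℕ.≤-trans (ℕ.m≤n+m _ (2 * suc f)) (ℕ.m≤n+m _ N₁)) N₀≤n)
                     (ℕ.≤-trans (ℕ.m≤n*m n (C₀ * C₀)) C₀²n≤m²))
        instance
          Λ≢0 : ℕ.NonZero Λ
          Λ≢0 = ℕ.m*n≢0 32 (fingerprintRatio d f * suc f)
          n≢0 : ℕ.NonZero n
          n≢0 = >-nonZero (ℕ.≤-trans (s≤s z≤n) 2g≤n)
          m≢0 : ℕ.NonZero m
          m≢0 = >-nonZero (ℕ.≤-trans (>-nonZero⁻¹ (Λ * suc K) {{ℕ.m*n≢0 Λ (suc K)}}) ΛK≤m)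
        member : ∀ I → T (S n m I) → _
        member = S-member n m
        counted : SF ^ L * 2 ^ m ℕ.≤ b ^ L
        counted = Counting.count-bound {n} {m} (H n) (B n) K a d f (S n m) (codeg≤K n)
          (λ I t → proj₁ (member I t)) (λ I t → proj₁ (proj₂ (member I t)))
          (λ I t X BX → clear-denominator {d} {δ} 1≤dδ (proj₂ (proj₂ (member I t)) X BX))
          2a≤g (n≤aN n) (dichotomy n N₁≤n)
          2g≤n ΛK≤m quad
        0≤E : 0ℚ ≤ E
        0≤E = *-nonNeg (^ℚ-nonNeg δ (ℚ.<⇒≤ 0<δ) m) (0≤ι (card (B n) * b))
        conclude : (D ≤ 0ℚ) ⊎ ((D ^ℚ L) ℚ.* ι (2 ^ (1 * m)) ≤ ι (b ^ L))
        -- Powers preserve the order only on nonnegative numbers, so D ≤ |SF| may be raised to the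
        -- power L only when D is positive.
        conclude with D ℚ.≤? 0ℚ
        ... | yes D≤0 = inj₁ D≤0
        ... | no D≰0 = inj₂ (begin
          (D ^ℚ L) ℚ.* ι (2 ^ (1 * m))        ≤⟨ ℚ.*-monoʳ-≤-nonNeg (ι (2 ^ (1 * m))) {{ι-nonNegative {2 ^ (1 * m)}}} (^ℚ-mono (ℚ.<⇒≤ (ℚ.≰⇒> D≰0)) (sub-≤ (ι SF) E 0≤E) L) ⟩
          (ι SF ^ℚ L) ℚ.* ι (2 ^ (1 * m))   ≡⟨ cong₂ (λ i j → i ℚ.* ι (2 ^ j)) (sym (ι-^ SF L)) (ℕ.+-identityʳ m) ⟩
          ι (SF ^ L) ℚ.* ι (2 ^ m)            ≡⟨ ι-* (SF ^ L) (2 ^ m) ⟨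
          ι (SF ^ L * 2 ^ m)                  ≤⟨ ι-mono counted ⟩
          ι (b ^ L)                           ∎)
          where open ℚ.≤-Reasoning

  theorem-embedded : (α : ℚ) → 0ℚ < α → (H : (n : ℕ) → Hypergraph3 n) → (B : (n : ℕ) → Family n) →
    ((γ : ℚ) → 0ℚ < γ → ∃[ β ] (0ℚ < β × ((n : ℕ) (A : Subset n) → (α - β) ℚ.* ι n ≤ ι (∣ A ∣) →
      (β ℚ.* ι (eH (H n)) ≤ ι (eInduced (H n) A)) ⊎ (∃[ X ] (T (B n X) × ι (∣ A ─ X ∣) ≤ γ ℚ.* ι n))))) →
    (∃[ c ] ∃[ K ] ∃[ N ] (0ℚ < c × ((n : ℕ) → N ℕ.≤ n → (c ℚ.* ι (n * n) ≤ ι (eH (H n))) × (eH (H n) ℕ.≤ K * (n * n))))) →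
    CodegBounded H → ((n : ℕ) → α ℚ.* ι n ≤ ι (norm (B n))) →
    (δ : ℚ) → 0ℚ < δ → (S : (n m : ℕ) → Subset n → Bool) →
    (∀ n m I → T (S n m I) → ∣ I ∣ ≡ m × T (independentᵇ (H n) I) × (∀ X → T (B n X) → δ ℚ.* ι m ≤ ι (∣ I ─ X ∣))) →
    ∃[ C ] (0ℚ < C ×
      ∃[ p ] ∃[ q ] ∃[ N ]
        ((n m : ℕ) → N ℕ.≤ n → (C ℚ.* C) ℚ.* ι n ≤ ι (m * m) →
          let D = ι (countSub (S n m)) - (δ ^ℚ m) ℚ.* ι (card (B n) * binom (norm (B n)) m)
              b = binom (norm (B n)) m
          in (D ≤ 0ℚ) ⊎ ((D ^ℚ suc q) ℚ.* ι (2 ^ (suc p * m)) ≤ ι (b ^ suc q))))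
  theorem-embedded α 0<α H B stable (c , _ , N₁ , 0<c , edges) (K , codeg≤K) norm≥ δ 0<δ S S-member
    with a , a≢0 , 1≤aα ← ι-archimedean α 0<α
    with d , d≢0 , 1≤dδ ← ι-archimedean δ 0<δ
    -- γ is determined by α and δ alone; β is then obtained from it.
    with γ , 0<γ , hγ≡1 ← reciprocal (16 ^ d * (2 * a)) {{ℕ.m*n≢0 (16 ^ d) (2 * a) {{ℕ.m^n≢0 16 d}} {{ℕ.m*n≢0 2 a {{_}} {{a≢0}}}}}}
    with β , 0<β , stableβ ← stable γ 0<γ
    with t₁ , t₁≢0 , 1≤t₁β ← ι-archimedean β 0<β
    with t₂ , _ , 1≤t₂βc ← ι-archimedean (β ℚ.* c) (ℚ.positive⁻¹ (β ℚ.* c) {{ℚ.pos*pos⇒pos β {{positive 0<β}} c {{positive 0<c}}}}) =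
    -- Taking f to be the sum makes g = f + 1 exceed t₁, t₂ and 2a simultaneously.
    counting-theorem H B δ 0<δ S S-member a d (t₁ ℕ.+ (t₂ ℕ.+ 2 * a)) K N₁
      {{a≢0}} {{>-nonZero (ℕ.≤-trans (>-nonZero⁻¹ t₁ {{t₁≢0}}) (ℕ.m≤m+n t₁ _))}} codeg≤K 1≤dδ
      (ℕ.≤-trans (ℕ.≤-trans (ℕ.m≤n+m (2 * a) t₂) (ℕ.m≤n+m _ t₁)) (ℕ.n≤1+n _))
      (λ n → clear-denominator {a} {α} 1≤aα (norm≥ n))
      (λ n N₁≤n → stable⇒dichotomy {n} {α} {β} {γ} {c} (H n) (B n) (16 ^ d * (2 * a)) t₁ t₂ _ {{t₁≢0}} hγ≡1 1≤t₁β 1≤t₂βc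
        (ℕ.≤-trans (ℕ.m≤m+n t₁ _) (ℕ.n≤1+n _))
        (ℕ.≤-trans (ℕ.≤-trans (ℕ.m≤m+n t₂ (2 * a)) (ℕ.m≤n+m _ t₁)) (ℕ.n≤1+n _))
        (ℚ.<⇒≤ 0<β) (norm≥ n) (proj₁ (edges n N₁≤n)) (stableβ n))

theorem4p1 : (α : ℚ) → 0ℚ < α →
    (H : (n : ℕ) → Hypergraph3 n) → (B : (n : ℕ) → Family n) →
    Stable α H B → EdgesTheta H → CodegBounded H →
    ((n : ℕ) → α Data.Rational.* ⟦ n ⟧ ≤ ⟦ norm (B n) ⟧) →
    (δ : ℚ) → 0ℚ < δ →
    ∃[ C ] (0ℚ < C ×
      -- ε = (1 + p) / (1 + q)
      ∃[ p ] ∃[ q ] ∃[ N ]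
        ((n m : ℕ) → N ℕ.≤ n →
          -- m ≥ C √n  (equivalently m² ≥ C² n, as C > 0)
          (C Data.Rational.* C) Data.Rational.* ⟦ n ⟧ ≤ ⟦ m * m ⟧ →
          -- D = |SF| − δ^m |B_n| binom(‖B_n‖, m);  claim: D ≤ 2^(-ε m) binom(‖B_n‖, m)
          let D = ⟦ SFcount (H n) (B n) δ m ⟧
                  - (δ ^ℚ m) Data.Rational.* ⟦ card (B n) * (binom (norm (B n)) m) ⟧
              b = binom (norm (B n)) m
          in (D ≤ 0ℚ) ⊎ ((D ^ℚ suc q) Data.Rational.* ⟦ 2 ^ (suc p * m) ⟧ ≤ ⟦ b ^ suc q ⟧)))
theorem4p1 α 0<α H B stable edges codeg≤K norm≥ δ 0<δ =
  Embedded.theorem-embedded ⟦_⟧ 0≤⟦⟧ refl ⟦⟧-mono ⟦⟧-cancel ⟦⟧-+ ⟦⟧-* archimedean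
    α 0<α H B stable edges codeg≤K norm≥ δ 0<δ (λ n m → inSFᵇ (H n) (B n) δ m) (λ n m → inSF⁻ (H n) (B n) δ m)
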